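{- Let $\rho^{\mathrm{ab}}_{\mathbf q}$ be the abelian complexity function of the $4$-bonacci word $\mathbf q$. Then: (1) $\{\rho^{\mathrm{ab}}_{\mathbf q}(n): n\in\mathbb N\}=\{4\}\cup\{6,7,\ldots,16\}$; (2) $\rho^{\mathrm{ab}}_{\mathbf q}(n)=4$ if and only if $\langle n\rangle_Q$ is a prefix of $100010001000\cdots$; (3) $\rho^{\mathrm{ab}}_{\mathbf q}(n)=6$ if and only if $n\in\{3,6,12\}$; (4) for every $c\in\{7,\ldots,16\}$ there exist infinitely many $n\in\mathbb N$ with $\rho^{\mathrm{ab}}_{\mathbf q}(n)=c$.
   Context: The $4$-bonacci word $\mathbf q$ is the fixed point of the substitution $0\mapsto01,\ 1\mapsto02,\ 2\mapsto03,\ 3\mapsto0$ over $\{0,1,2,3\}$. Its abelian complexity $\rho^{\mathrm{ab}}_{\mathbf q}(n)$ is the number of distinct Parikh vectors $(|w|_0,|w|_1,|w|_2,|w|_3)$ over all factors $w$ of $\mathbf q$ of length $n$. Tetranacci numbers: $Q_0=Q_1=Q_2=0$, $Q_3=1$, $Q_j=Q_{j-1}+Q_{j-2}+Q_{j-3}+Q_{j-4}$. The $4$-bonacci representation $\langle n\rangle_Q=d_k\cdots d_0$ of $n\in\mathbb N$ is the digit string with $d_j\in\{0,1\}$, $n=\sum_jd_jQ_{j+4}$, obtained by the greedy algorithm, written without leading zeros. -}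

module Defs where

open import Data.Nat using (ℕ; zero; suc; _+_; _∸_; _≤?_; _%_; _≡ᵇ_)
open import Data.Fin using (Fin; zero; suc)
open import Data.Fin.Properties using () renaming (_≟_ to _≟ᶠ_)
open import Data.Bool using (Bool; true; false; if_then_else_)
open import Data.List using (List; []; _∷_; _++_; concatMap; length; filter; applyUpTo; upTo; map)
open import Data.Vec using (Vec; tabulate)
open import Data.Product using (Σ; ∃; _×_)
open import Data.List.Relation.Unary.All using (All)
open import Data.List.Relation.Unary.Unique.Propositional using (Unique)
open import Data.List.Membership.Propositional using (_∈_)
open import Relation.Nullary.Decidable using (does)
open import Relation.Binary.PropositionalEquality using (_≡_)

σ : Fin 4 → List (Fin 4)
σ zero = zero ∷ suc zero ∷ []
σ (suc zero) = zero ∷ suc (suc zero) ∷ []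
σ (suc (suc zero)) = zero ∷ suc (suc (suc zero)) ∷ []
σ (suc (suc (suc zero))) = zero ∷ []

σ* : List (Fin 4) → List (Fin 4)
σ* = concatMap σ

σⁿ0 : ℕ → List (Fin 4)
σⁿ0 zero = zero ∷ []
σⁿ0 (suc k) = σ* (σⁿ0 k)

lookupD : List (Fin 4) → ℕ → Fin 4
lookupD [] _ = zero
lookupD (x ∷ _) zero = x
lookupD (_ ∷ xs) (suc i) = lookupD xs i

-- The fixed point q = lim σ^k(0); the letter q(i) (0-indexed) is the i-th
-- letter of σ^(i+1)(0), whose length is ≥ i+2, and which is a prefix of q.
q : ℕ → Fin 4
q i = lookupD (σⁿ0 (suc i)) i

factor : ℕ → ℕ → List (Fin 4)
factor i n = applyUpTo (λ k → q (i + k)) n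

count : Fin 4 → List (Fin 4) → ℕ
count a w = length (filter (λ b → b ≟ᶠ a) w)

parikh : List (Fin 4) → Vec ℕ 4
parikh w = tabulate (λ a → count a w)

AbComplexity : ℕ → ℕ → Set
AbComplexity n c =
  Σ (List (Vec ℕ 4)) λ L →
    length L ≡ c × Unique L ×
    (∀ i → parikh (factor i n) ∈ L) ×
    All (λ v → ∃ λ i → parikh (factor i n) ≡ v) L

Q : ℕ → ℕ
Q 0 = 0
Q 1 = 0
Q 2 = 0
Q 3 = 1
Q (suc (suc (suc (suc j)))) = Q (suc (suc (suc j))) + Q (suc (suc j)) + Q (suc j) + Q j

-- Largest j ≤ bound with Q_{j+4} ≤ n (0 if none).
topIndex : ℕ → ℕ → ℕ
topIndex n zero = zero
topIndex n (suc j) = if does (Q (suc j + 4) ≤? n) then suc j else topIndex n j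

greedy : ℕ → ℕ → List Bool
greedy zero r = []
greedy (suc j) r =
  if does (Q (j + 4) ≤? r) then true ∷ greedy j (r ∸ Q (j + 4)) else false ∷ greedy j r

-- ⟨n⟩_Q = d_k ⋯ d_0 (most significant digit first; true = 1), for n ≥ 1.
-- k is the largest index with Q_{k+4} ≤ n (note k < n since Q_{j+4} ≥ j+1).
rep : ℕ → List Bool
rep n = greedy (suc (topIndex n n)) n

pattern1000 : ℕ → List Bool
pattern1000 L = map (λ i → (i % 4) ≡ᵇ 0) (upTo L)

IsPrefixOf1000 : List Bool → Set
IsPrefixOf1000 w = w ≡ pattern1000 (length w)

{-# OPTIONS --safe #-}
module Submission where

open import Defs
open import Data.Nat using (ℕ; _≤_; _<_)
open import Data.Product using (_×_; ∃; Σ)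
open import Data.Sum using (_⊎_)
open import Function.Bundles using (_⇔_)
open import Relation.Binary.PropositionalEquality using (_≡_)

open import Data.Nat as ℕ using (zero; suc; z≤n; s≤s; _∸_; _/_; _%_; _≤?_; _≡ᵇ_; _≤ᵇ_; _<ᵇ_)
import Data.Nat.Properties as ℕₚ
open import Data.Nat.DivMod using (m%n<n; m≡m%n+[m/n]*n)
open import Data.Nat.Induction using (<-rec)
open import Data.Integer using (ℤ; +_; -[1+_]; _+_; _-_; +≤+) renaming (_≤_ to _≤ᶻ_)
import Data.Integer.Properties as ℤₚ
open import Data.Integer.Tactic.RingSolver using (solve-∀)
open import Data.Bool using (Bool; true; false; if_then_else_; not; _∧_; _∨_; T)
open import Data.Bool.ListAction using (all; any)
open import Data.Bool.Properties using (T-∧; T-∨)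
open import Data.Fin using (Fin; zero; suc; toℕ)
open import Data.Fin.Properties using (toℕ<n) renaming (_≟_ to _≟ᶠ_)
open import Data.List using (List; []; _∷_; _++_; [_]; length; map; concatMap; filter; filterᵇ; deduplicate; foldr; applyUpTo; upTo)
open import Data.List.Properties using (length-++; length-map; length-applyUpTo; length-upTo; applyUpTo-∷ʳ; upTo-∷ʳ; map-upTo; map-++; filter-++; concatMap-++; ++-identityʳ; ++-cancelˡ; ∷-injectiveˡ; ∷-injectiveʳ)
open import Data.List.Membership.Propositional using (_∈_; find; lose)
open import Data.List.Membership.Propositional.Properties using (∈-concatMap⁺; ∈-concatMap⁻; ∈-map⁺; ∈-map⁻; ∈-filter⁺; ∈-filter⁻; ∈-deduplicate⁺; ∈-deduplicate⁻; ∈-∃++; ∈-++⁻; ∈-++⁺ˡ; ∈-++⁺ʳ; ∈-applyUpTo⁺; ∈-upTo⁺)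
open import Data.List.Relation.Unary.Any using (here; there)
open import Data.List.Relation.Unary.Any.Properties using (any⁻)
open import Data.List.Relation.Unary.All as All using (All; []; _∷_)
open import Data.List.Relation.Unary.All.Properties using (all⁺)
open import Data.List.Relation.Unary.AllPairs using ([]; _∷_)
open import Data.List.Relation.Unary.Unique.Propositional using (Unique)
import Data.List.Relation.Unary.Unique.Propositional.Properties as Uniqueₚ
import Data.List.Relation.Unary.Unique.DecPropositional.Properties as Dedup
open import Data.Vec using (Vec; []; _∷_)
open import Data.Product using (_,_; proj₁; proj₂)
open import Data.Sum using (inj₁; inj₂)
open import Data.Empty using (⊥; ⊥-elim)
open import Data.Unit using (tt)
open import Function.Base using (_∘_)
open import Function.Bundles using (Equivalence; mk⇔)
open import Relation.Nullary using (¬_; Dec; yes; no; does)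
open import Relation.Nullary.Decidable using (map′; _×-dec_; T?; dec-true; dec-false)
open import Relation.Binary.PropositionalEquality using (_≢_; refl; sym; trans; cong; cong₂; subst; subst₂)

-- Let ψ(m) be the Parikh vector of the prefix of q of length m and p(m) the position at which the image of
-- the m-th letter starts.  Every position is p(m) or p(m) + 1, and ψ(p(m) + d) is the incidence matrix applied
-- to ψ(m) plus d times the letter 0.  Hence δ = ψ(j) - ψ(i) - ψ(n) evolves linearly when one digit is appended
-- to each of i, j and n, and the Parikh vectors of the factors of length n are ψ(n) + δ with j = i + n.  Since
-- the substitution is Pisot, only finitely many δ can still lead to j = i + n: the others grow forever in
-- the same direction.  The pairs (i, j) thus turn into a finite set of elements (letter of i, letter of j, δ),
-- and appending a digit to n maps this set to the next one.  A finite family of sets closed under this map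
-- from above bounds the complexity by 16; another one, closed from below, bounds it by 7 for all n except
-- 3, 6, 12 and those on the path 1000 1000 ⋯, along which the set is eventually periodic.  The values
-- 7, …, 16 are reached by leaving that path at the end of any period.

-- Positions and the substitution

-- The obstacle is the carry: the digits of i + n cannot be read off those of i and n from left to
-- right. So i, j and n receive their digits independently, and differences with j ≠ i + n have to
-- be carried along, since a triple with j = i + n may descend from triples without this property.
-- It must then be decidable which triples are hopeless. `Above` and `Below` demand an inequality
-- between lengths under every power of the substitution; these lengths satisfy a recurrence with
-- nonnegative coefficients, so four initial values suffice to certify it. Exact sets exist for
-- every n, but a bound needs only one side: realised elements bound the complexity from below, a
-- covering set bounds it from above. Sets may therefore be shrunk in the one case and enlarged in
-- the other until finitely many of them are closed under both digits. How these families were found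
-- is irrelevant to the proof, which only checks their closure by evaluation.

pre : ℕ → List (Fin 4)
pre = applyUpTo q

1≤∣σ∣ : ∀ a → 1 ≤ length (σ a)
1≤∣σ∣ zero = s≤s z≤n
1≤∣σ∣ (suc zero) = s≤s z≤n
1≤∣σ∣ (suc (suc zero)) = s≤s z≤n
1≤∣σ∣ (suc (suc (suc zero))) = s≤s z≤n

∣w∣≤∣σ*w∣ : ∀ w → length w ≤ length (σ* w)
∣w∣≤∣σ*w∣ [] = z≤n
∣w∣≤∣σ*w∣ (a ∷ w) = subst (suc (length w) ≤_) (sym (length-++ (σ a)))
  (ℕₚ.+-mono-≤ (1≤∣σ∣ a) (∣w∣≤∣σ*w∣ w))

σⁿ0-extends : ∀ k → ∃ λ r → σⁿ0 (suc k) ≡ σⁿ0 k ++ r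
σⁿ0-extends zero = _ , refl
σⁿ0-extends (suc k) with σⁿ0-extends k
... | r , eq = σ* r , trans (cong σ* eq) (concatMap-++ σ (σⁿ0 k) r)

σⁿ0-starts : ∀ k → ∃ λ r → σⁿ0 k ≡ zero ∷ r
σⁿ0-starts zero = [] , refl
σⁿ0-starts (suc k) with σⁿ0 k | σⁿ0-starts k
... | _ | r , refl = _ , refl

∣σⁿ0∣-grows : ∀ k → suc k ≤ length (σⁿ0 k)
∣σⁿ0∣-grows zero = s≤s z≤n
∣σⁿ0∣-grows (suc k) with σⁿ0 k | σⁿ0-starts k | ∣σⁿ0∣-grows k
... | _ | r , refl | s≤s h = s≤s (s≤s (ℕₚ.≤-trans h (∣w∣≤∣σ*w∣ r)))

lookupD-++ˡ : ∀ u r {i} → i < length u → lookupD (u ++ r) i ≡ lookupD u i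
lookupD-++ˡ (x ∷ u) r {zero} _ = refl
lookupD-++ˡ (x ∷ u) r {suc i} (s≤s h) = lookupD-++ˡ u r h

lookupD-stable : ∀ d k {i} → i < length (σⁿ0 k) → lookupD (σⁿ0 (d ℕ.+ k)) i ≡ lookupD (σⁿ0 k) i
lookupD-stable zero k h = refl
lookupD-stable (suc d) k {i} h with σⁿ0-extends (d ℕ.+ k)
... | r , eq = trans (cong (λ w → lookupD w i) eq)
  (trans (lookupD-++ˡ (σⁿ0 (d ℕ.+ k)) r (long d)) (lookupD-stable d k h))
  where
  long : ∀ d → i < length (σⁿ0 (d ℕ.+ k))
  long zero = h
  long (suc d) = ℕₚ.<-≤-trans (long d) (∣w∣≤∣σ*w∣ (σⁿ0 (d ℕ.+ k)))

-- `q i` is read from the iterate of index i + 1; it and the iterate of index k are both prefixes of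
-- the iterate of index k + i + 1, where the two letters are compared.
q-lookup : ∀ k {i} → i < length (σⁿ0 k) → q i ≡ lookupD (σⁿ0 k) i
q-lookup k {i} h = trans (sym (lookupD-stable k (suc i) (ℕₚ.<-trans (ℕₚ.n<1+n i) (∣σⁿ0∣-grows (suc i)))))
  (trans (cong (λ m → lookupD (σⁿ0 m) i) (ℕₚ.+-comm k (suc i))) (lookupD-stable (suc i) k h))

applyUpTo-lookup : ∀ (f : ℕ → Fin 4) u → (∀ {i} → i < length u → f i ≡ lookupD u i) → applyUpTo f (length u) ≡ u
applyUpTo-lookup f [] h = refl
applyUpTo-lookup f (x ∷ u) h = cong₂ _∷_ (h (s≤s z≤n)) (applyUpTo-lookup (λ i → f (suc i)) u (λ l → h (s≤s l)))

pre-prefix : ∀ k u r → σⁿ0 k ≡ u ++ r → pre (length u) ≡ u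
pre-prefix k u r eq = applyUpTo-lookup q u λ {i} l →
  trans (q-lookup k (subst (i <_) (sym (trans (cong length eq) (length-++ u))) (ℕₚ.<-≤-trans l (ℕₚ.m≤m+n _ _))))
        (trans (cong (λ w → lookupD w i) eq) (lookupD-++ˡ u r l))

applyUpTo-+ : ∀ (f : ℕ → Fin 4) m n → applyUpTo f (m ℕ.+ n) ≡ applyUpTo f m ++ applyUpTo (λ i → f (m ℕ.+ i)) n
applyUpTo-+ f zero n = refl
applyUpTo-+ f (suc m) n = cong (f 0 ∷_) (applyUpTo-+ (λ i → f (suc i)) m n)

pre-in-σⁿ0 : ∀ m → ∃ λ r → σⁿ0 m ≡ pre m ++ r
pre-in-σⁿ0 m with ℕₚ.m≤n⇒∃[o]m+o≡n (ℕₚ.<⇒≤ (∣σⁿ0∣-grows m))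
... | o , eq = _ , trans (sym (pre-prefix m (σⁿ0 m) [] (sym (++-identityʳ _))))
  (trans (cong pre (sym eq)) (applyUpTo-+ q m o))

-- The position in q at which the image of the m-th letter starts.
p : ℕ → ℕ
p zero = 0
p (suc m) = p m ℕ.+ length (σ (q m))

pre-suc : ∀ m → pre (suc m) ≡ pre m ++ [ q m ]
pre-suc m = sym (applyUpTo-∷ʳ q m)

σ*-snoc : ∀ w a → σ* (w ++ [ a ]) ≡ σ* w ++ σ a
σ*-snoc w a = trans (concatMap-++ σ w [ a ]) (cong (σ* w ++_) (++-identityʳ (σ a)))

∣σ*pre∣ : ∀ m → length (σ* (pre m)) ≡ p m
∣σ*pre∣ zero = refl
∣σ*pre∣ (suc m) = trans (cong (λ w → length (σ* w)) (pre-suc m))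
  (trans (cong length (σ*-snoc (pre m) (q m)))
  (trans (length-++ (σ* (pre m))) (cong (ℕ._+ length (σ (q m))) (∣σ*pre∣ m))))

-- The fixed-point property of q: `pre m` is a prefix of the m-th iterate, so its image is a prefix
-- of the next one, and every prefix of an iterate is a prefix of q.
σ*pre : ∀ m → σ* (pre m) ≡ pre (p m)
σ*pre m with pre-in-σⁿ0 m
... | r , eq = trans (sym (pre-prefix (suc m) (σ* (pre m)) (σ* r) (trans (cong σ* eq) (concatMap-++ σ (pre m) r))))
  (cong pre (∣σ*pre∣ m))

σq : ∀ m → applyUpTo (λ i → q (p m ℕ.+ i)) (length (σ (q m))) ≡ σ (q m)
σq m = ++-cancelˡ (pre (p m)) _ _ (trans (sym (applyUpTo-+ q (p m) (length (σ (q m)))))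
  (trans (sym (σ*pre (suc m))) (trans (cong σ* (pre-suc m))
  (trans (σ*-snoc (pre m) (q m)) (cong (_++ σ (q m)) (σ*pre m))))))

qℕ : ℕ → ℕ
qℕ i = toℕ (q i)

-- Appending the digit d to the representation of m gives that of the child. By `q-first` and
-- `q-second` the letter at a position counts the trailing ones, so the condition on `second`
-- forbids 1111.
data Child (m : ℕ) : ℕ → ℕ → Set where
  first : Child m 0 (p m)
  second : qℕ m < 3 → Child m 1 (suc (p m))

q-first : ∀ m → qℕ (p m) ≡ 0
q-first m = trans (cong qℕ (sym (ℕₚ.+-identityʳ (p m)))) go
  where
  go : qℕ (p m ℕ.+ 0) ≡ 0
  go with q m | σq m
  ... | zero | eq = cong toℕ (∷-injectiveˡ eq)
  ... | suc zero | eq = cong toℕ (∷-injectiveˡ eq)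
  ... | suc (suc zero) | eq = cong toℕ (∷-injectiveˡ eq)
  ... | suc (suc (suc zero)) | eq = cong toℕ (∷-injectiveˡ eq)

q-second : ∀ m → qℕ m < 3 → qℕ (suc (p m)) ≡ suc (qℕ m)
q-second m h = trans (cong qℕ (sym (ℕₚ.+-comm (p m) 1))) (go h)
  where
  go : qℕ m < 3 → qℕ (p m ℕ.+ 1) ≡ suc (qℕ m)
  go h with q m | σq m
  ... | zero | eq = cong toℕ (∷-injectiveˡ (∷-injectiveʳ eq))
  ... | suc zero | eq = cong toℕ (∷-injectiveˡ (∷-injectiveʳ eq))
  ... | suc (suc zero) | eq = cong toℕ (∷-injectiveˡ (∷-injectiveʳ eq))
  ... | suc (suc (suc zero)) | eq = ⊥-elim (ℕₚ.<-irrefl refl h)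

∣σ∣-view : ∀ a → (toℕ a < 3 × length (σ a) ≡ 2) ⊎ (toℕ a ≡ 3 × length (σ a) ≡ 1)
∣σ∣-view zero = inj₁ (s≤s z≤n , refl)
∣σ∣-view (suc zero) = inj₁ (s≤s (s≤s z≤n) , refl)
∣σ∣-view (suc (suc zero)) = inj₁ (s≤s (s≤s (s≤s z≤n)) , refl)
∣σ∣-view (suc (suc (suc zero))) = inj₂ (refl , refl)

p-suc-long : ∀ m → qℕ m < 3 → p (suc m) ≡ suc (suc (p m))
p-suc-long m h with ∣σ∣-view (q m)
... | inj₁ (_ , eq) = trans (cong (p m ℕ.+_) eq) (ℕₚ.+-comm (p m) 2)
... | inj₂ (eq , _) = ⊥-elim (ℕₚ.<-irrefl eq h)

parent : ∀ x → ∃ λ m → ∃ λ d → Child m d x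
parent zero = 0 , 0 , first
parent (suc x) with parent x
... | m , .1 , second h = suc m , 0 , subst (Child (suc m) 0) (p-suc-long m h) first
... | m , .0 , first with ∣σ∣-view (q m)
...   | inj₁ (h , _) = m , 1 , second h
...   | inj₂ (_ , eq) = suc m , 0 , subst (Child (suc m) 0) (trans (cong (p m ℕ.+_) eq) (ℕₚ.+-comm (p m) 1)) first

-- Makes parents strictly smaller than their children, except that 0 is its own parent; this is what
-- induction over digits rests on.
p-grows : ∀ m → 2 ℕ.+ m ≤ p (suc m)
p-grows zero = s≤s (s≤s z≤n)
p-grows (suc m) = ℕₚ.≤-trans (subst (_≤ p (suc m) ℕ.+ 1) (ℕₚ.+-comm (2 ℕ.+ m) 1) (ℕₚ.+-monoˡ-≤ 1 (p-grows m)))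
  (ℕₚ.+-monoʳ-≤ (p (suc m)) (1≤∣σ∣ (q (suc m))))

p-≤ : ∀ {m d x} → Child m d x → p m ≤ x
p-≤ first = ℕₚ.≤-refl
p-≤ (second h) = ℕₚ.n≤1+n _

child-< : ∀ {m d x} → Child m d x → 1 ≤ x → m < x
child-< {zero} _ h = h
child-< {suc m} c _ = ℕₚ.≤-trans (p-grows m) (p-≤ c)

child-≤ : ∀ {m d x} → Child m d x → m ≤ x
child-≤ {zero} c = z≤n
child-≤ {suc m} c = ℕₚ.<⇒≤ (ℕₚ.≤-trans (p-grows m) (p-≤ c))

child-suc-≤ : ∀ {m d x} → Child m d x → suc x ≤ p (suc m)
child-suc-≤ {m} first = subst (_≤ p (suc m)) (ℕₚ.+-comm (p m) 1) (ℕₚ.+-monoʳ-≤ (p m) (1≤∣σ∣ (q m)))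
child-suc-≤ {m} (second h) = ℕₚ.≤-reflexive (sym (p-suc-long m h))

-- Parikh vectors and length functionals

0F 1F 2F 3F : Fin 4
0F = zero
1F = suc zero
2F = suc (suc zero)
3F = suc (suc (suc zero))

count-++ : ∀ a u v → count a (u ++ v) ≡ count a u ℕ.+ count a v
count-++ a u v = trans (cong length (filter-++ (_≟ᶠ a) u v)) (length-++ (filter (_≟ᶠ a) u))

count-total : ∀ w → count 0F w ℕ.+ count 1F w ℕ.+ count 2F w ℕ.+ count 3F w ≡ length w
count-total [] = refl
count-total (zero ∷ w) = cong suc (count-total w)
count-total (suc zero ∷ w) = trans (cong (λ m → m ℕ.+ count 2F w ℕ.+ count 3F w) (ℕₚ.+-suc (count 0F w) (count 1F w)))
  (cong suc (count-total w))
count-total (suc (suc zero) ∷ w) = trans (cong (ℕ._+ count 3F w) (ℕₚ.+-suc (count 0F w ℕ.+ count 1F w) (count 2F w)))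
  (cong suc (count-total w))
count-total (suc (suc (suc zero)) ∷ w) = trans (ℕₚ.+-suc (count 0F w ℕ.+ count 1F w ℕ.+ count 2F w) (count 3F w))
  (cong suc (count-total w))

count₀-σ* : ∀ w → count 0F (σ* w) ≡ length w
count₀-σ* [] = refl
count₀-σ* (zero ∷ w) = cong suc (count₀-σ* w)
count₀-σ* (suc zero ∷ w) = cong suc (count₀-σ* w)
count₀-σ* (suc (suc zero) ∷ w) = cong suc (count₀-σ* w)
count₀-σ* (suc (suc (suc zero)) ∷ w) = cong suc (count₀-σ* w)

count₁-σ* : ∀ w → count 1F (σ* w) ≡ count 0F w
count₁-σ* [] = refl
count₁-σ* (zero ∷ w) = cong suc (count₁-σ* w)
count₁-σ* (suc zero ∷ w) = count₁-σ* w
count₁-σ* (suc (suc zero) ∷ w) = count₁-σ* w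
count₁-σ* (suc (suc (suc zero)) ∷ w) = count₁-σ* w

count₂-σ* : ∀ w → count 2F (σ* w) ≡ count 1F w
count₂-σ* [] = refl
count₂-σ* (zero ∷ w) = count₂-σ* w
count₂-σ* (suc zero ∷ w) = cong suc (count₂-σ* w)
count₂-σ* (suc (suc zero) ∷ w) = count₂-σ* w
count₂-σ* (suc (suc (suc zero)) ∷ w) = count₂-σ* w

count₃-σ* : ∀ w → count 3F (σ* w) ≡ count 2F w
count₃-σ* [] = refl
count₃-σ* (zero ∷ w) = count₃-σ* w
count₃-σ* (suc zero ∷ w) = count₃-σ* w
count₃-σ* (suc (suc zero) ∷ w) = cong suc (count₃-σ* w)
count₃-σ* (suc (suc (suc zero)) ∷ w) = count₃-σ* w

record ℤ⁴ : Set where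
  constructor ⟨_,_,_,_⟩
  field x₀ x₁ x₂ x₃ : ℤ
open ℤ⁴ public

⟨⟩-cong : ∀ {x y z w x′ y′ z′ w′} → x ≡ x′ → y ≡ y′ → z ≡ z′ → w ≡ w′ → ⟨ x , y , z , w ⟩ ≡ ⟨ x′ , y′ , z′ , w′ ⟩
⟨⟩-cong refl refl refl refl = refl

infixl 6 _⊕_ _⊝_
_⊕_ _⊝_ : ℤ⁴ → ℤ⁴ → ℤ⁴
u ⊕ v = ⟨ x₀ u + x₀ v , x₁ u + x₁ v , x₂ u + x₂ v , x₃ u + x₃ v ⟩
u ⊝ v = ⟨ x₀ u - x₀ v , x₁ u - x₁ v , x₂ u - x₂ v , x₃ u - x₃ v ⟩

total : ℤ⁴ → ℤ
total v = x₀ v + x₁ v + x₂ v + x₃ v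

0⁴ : ℤ⁴
0⁴ = ⟨ + 0 , + 0 , + 0 , + 0 ⟩

-- Index 4 acts as an empty letter: `M (+ 0)` sends `e a` to `e 0 ⊕ e (suc a)` for a = 3 as well.
e : ℕ → ℤ⁴
e 0 = ⟨ + 1 , + 0 , + 0 , + 0 ⟩
e 1 = ⟨ + 0 , + 1 , + 0 , + 0 ⟩
e 2 = ⟨ + 0 , + 0 , + 1 , + 0 ⟩
e 3 = ⟨ + 0 , + 0 , + 0 , + 1 ⟩
e _ = 0⁴

-- The incidence matrix of σ, followed by the addition of c times the letter 0.
M : ℤ → ℤ⁴ → ℤ⁴
M c v = ⟨ total v + c , x₀ v , x₁ v , x₂ v ⟩

toℤ⁴ : List (Fin 4) → ℤ⁴
toℤ⁴ w = ⟨ + count 0F w , + count 1F w , + count 2F w , + count 3F w ⟩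

toℤ⁴-++ : ∀ u v → toℤ⁴ (u ++ v) ≡ toℤ⁴ u ⊕ toℤ⁴ v
toℤ⁴-++ u v = ⟨⟩-cong (c 0F) (c 1F) (c 2F) (c 3F)
  where
  c : ∀ a → + count a (u ++ v) ≡ + count a u + + count a v
  c a = cong +_ (count-++ a u v)

total-toℤ⁴ : ∀ w → total (toℤ⁴ w) ≡ + length w
total-toℤ⁴ w = cong +_ (count-total w)

toℤ⁴-σ* : ∀ w → toℤ⁴ (σ* w) ≡ M (+ 0) (toℤ⁴ w)
toℤ⁴-σ* w = ⟨⟩-cong (trans (cong +_ (count₀-σ* w)) (trans (sym (total-toℤ⁴ w)) (sym (ℤₚ.+-identityʳ _))))
  (cong +_ (count₁-σ* w)) (cong +_ (count₂-σ* w)) (cong +_ (count₃-σ* w))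

toℤ⁴-letter : ∀ a → toℤ⁴ [ a ] ≡ e (toℕ a)
toℤ⁴-letter zero = refl
toℤ⁴-letter (suc zero) = refl
toℤ⁴-letter (suc (suc zero)) = refl
toℤ⁴-letter (suc (suc (suc zero))) = refl

ψ : ℕ → ℤ⁴
ψ m = toℤ⁴ (pre m)

total-ψ : ∀ m → total (ψ m) ≡ + m
total-ψ m = trans (total-toℤ⁴ (pre m)) (cong +_ (length-applyUpTo q m))

ψ-suc : ∀ m → ψ (suc m) ≡ ψ m ⊕ e (qℕ m)
ψ-suc m = trans (cong toℤ⁴ (pre-suc m)) (trans (toℤ⁴-++ (pre m) [ q m ]) (cong (ψ m ⊕_) (toℤ⁴-letter (q m))))

ψ-p : ∀ m → ψ (p m) ≡ M (+ 0) (ψ m)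
ψ-p m = trans (cong toℤ⁴ (sym (σ*pre m))) (toℤ⁴-σ* (pre m))

ψ-child : ∀ {m d x} → Child m d x → ψ x ≡ M (+ d) (ψ m)
ψ-child {m} first = ψ-p m
ψ-child {m} (second h) = trans (ψ-suc (p m)) (trans (cong₂ _⊕_ (ψ-p m) (cong e (q-first m)))
  (⟨⟩-cong (cong (_+ + 1) (ℤₚ.+-identityʳ (total (ψ m)))) (ℤₚ.+-identityʳ _) (ℤₚ.+-identityʳ _) (ℤₚ.+-identityʳ _)))

δ : ℕ → ℕ → ℕ → ℤ⁴
δ i j n = ψ j ⊝ ψ i ⊝ ψ n

M-⊝ : ∀ c c′ u v → M c u ⊝ M c′ v ≡ M (c - c′) (u ⊝ v)
M-⊝ c c′ u v = ⟨⟩-cong (eq c c′ (x₀ u) (x₁ u) (x₂ u) (x₃ u) (x₀ v) (x₁ v) (x₂ v) (x₃ v)) refl refl refl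
  where
  eq : ∀ c c′ a b d e a′ b′ d′ e′ → a + b + d + e + c - (a′ + b′ + d′ + e′ + c′)
     ≡ a - a′ + (b - b′) + (d - d′) + (e - e′) + (c - c′)
  eq = solve-∀

δ-child : ∀ {i j n i′ j′ n′ d d′ f} → Child i d i′ → Child j d′ j′ → Child n f n′
  → δ i′ j′ n′ ≡ M (+ d′ - + d - + f) (δ i j n)
δ-child {i} {j} {n} {d = d} {d′} {f} ci cj cn = trans
  (cong₂ _⊝_ (trans (cong₂ _⊝_ (ψ-child cj) (ψ-child ci)) (M-⊝ (+ d′) (+ d) (ψ j) (ψ i))) (ψ-child cn))
  (M-⊝ (+ d′ - + d) (+ f) (ψ j ⊝ ψ i) (ψ n))

-- Λ k v is the length of σᵏ(w) for any w with Parikh vector v.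
Λ : ℕ → ℤ⁴ → ℤ
Λ zero v = total v
Λ (suc k) v = Λ k (M (+ 0) v)

Λ-⊕ : ∀ k u v → Λ k (u ⊕ v) ≡ Λ k u + Λ k v
Λ-⊕ zero u v = eq (x₀ u) (x₁ u) (x₂ u) (x₃ u) (x₀ v) (x₁ v) (x₂ v) (x₃ v)
  where
  eq : ∀ a b d e a′ b′ d′ e′ → a + a′ + (b + b′) + (d + d′) + (e + e′) ≡ a + b + d + e + (a′ + b′ + d′ + e′)
  eq = solve-∀
Λ-⊕ (suc k) u v = trans (cong (Λ k) (⟨⟩-cong (eq (x₀ u) (x₁ u) (x₂ u) (x₃ u) (x₀ v) (x₁ v) (x₂ v) (x₃ v)) refl refl refl))
  (Λ-⊕ k (M (+ 0) u) (M (+ 0) v))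
  where
  eq : ∀ a b d e a′ b′ d′ e′ → a + a′ + (b + b′) + (d + d′) + (e + e′) + + 0 ≡ (a + b + d + e + + 0) + (a′ + b′ + d′ + e′ + + 0)
  eq = solve-∀

⊝-⊕ : ∀ u v → u ⊝ v ⊕ v ≡ u
⊝-⊕ u v = ⟨⟩-cong (eq (x₀ u) (x₀ v)) (eq (x₁ u) (x₁ v)) (eq (x₂ u) (x₂ v)) (eq (x₃ u) (x₃ v))
  where
  eq : ∀ a b → a - b + b ≡ a
  eq = solve-∀

Λ-0⁴ : ∀ k → Λ k 0⁴ ≡ + 0
Λ-0⁴ zero = refl
Λ-0⁴ (suc k) = Λ-0⁴ k

-- The incidence matrix has characteristic polynomial x⁴ - x³ - x² - x - 1.
Λ-recurrence : ∀ k v → Λ (4 ℕ.+ k) v ≡ Λ (3 ℕ.+ k) v + Λ (2 ℕ.+ k) v + Λ (1 ℕ.+ k) v + Λ k v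
Λ-recurrence zero v = eq (Λ 3 v) (Λ 2 v) (Λ 1 v) (Λ 0 v)
  where
  eq : ∀ a b c d → a + + 0 + (b + + 0) + (c + + 0) + (d + + 0) ≡ a + b + c + d
  eq = solve-∀
Λ-recurrence (suc k) v = Λ-recurrence k (M (+ 0) v)

Λ-nonneg : ∀ v → + 0 ≤ᶻ Λ 0 v → + 0 ≤ᶻ Λ 1 v → + 0 ≤ᶻ Λ 2 v → + 0 ≤ᶻ Λ 3 v → ∀ k → + 0 ≤ᶻ Λ k v
Λ-nonneg v h₀ h₁ h₂ h₃ zero = h₀
Λ-nonneg v h₀ h₁ h₂ h₃ (suc k) = Λ-nonneg (M (+ 0) v) h₁ h₂ h₃
  (subst (+ 0 ≤ᶻ_) (sym (Λ-recurrence 0 v)) (ℤₚ.+-mono-≤ (ℤₚ.+-mono-≤ (ℤₚ.+-mono-≤ h₃ h₂) h₁) h₀)) k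

Λ-e₀-nonneg : ∀ k → + 0 ≤ᶻ Λ k (e 0)
Λ-e₀-nonneg = Λ-nonneg (e 0) (+≤+ z≤n) (+≤+ z≤n) (+≤+ z≤n) (+≤+ z≤n)

-- The images of a and a + 1 share the letter 0 and continue with a + 1 and a + 2, so the comparison
-- moves up one letter per application of the substitution until the empty letter is reached.
Λ-e-step : ∀ k a → Λ k (e (suc a)) ≤ᶻ Λ k (e a)
Λ-e-step zero 0 = +≤+ (s≤s z≤n)
Λ-e-step zero 1 = +≤+ (s≤s z≤n)
Λ-e-step zero 2 = +≤+ (s≤s z≤n)
Λ-e-step zero 3 = +≤+ z≤n
Λ-e-step k@(suc _) (suc (suc (suc (suc a)))) = ℤₚ.≤-refl
Λ-e-step zero (suc (suc (suc (suc a)))) = ℤₚ.≤-refl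
Λ-e-step (suc k) 0 = subst₂ _≤ᶻ_ (sym (Λ-⊕ k (e 0) (e 2))) (sym (Λ-⊕ k (e 0) (e 1))) (ℤₚ.+-monoʳ-≤ (Λ k (e 0)) (Λ-e-step k 1))
Λ-e-step (suc k) 1 = subst₂ _≤ᶻ_ (sym (Λ-⊕ k (e 0) (e 3))) (sym (Λ-⊕ k (e 0) (e 2))) (ℤₚ.+-monoʳ-≤ (Λ k (e 0)) (Λ-e-step k 2))
Λ-e-step (suc k) 2 = subst₂ _≤ᶻ_ (sym (Λ-⊕ k (e 0) (e 4))) (sym (Λ-⊕ k (e 0) (e 3))) (ℤₚ.+-monoʳ-≤ (Λ k (e 0)) (Λ-e-step k 3))
Λ-e-step (suc k) 3 = subst (_≤ᶻ Λ k (e 0)) (sym (Λ-0⁴ k)) (Λ-e₀-nonneg k)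

Λ-e-antitone : ∀ k {a b} → a ≤ b → Λ k (e b) ≤ᶻ Λ k (e a)
Λ-e-antitone k {a} a≤b = go (ℕₚ.≤⇒≤′ a≤b)
  where
  go : ∀ {b} → a ℕ.≤′ b → Λ k (e b) ≤ᶻ Λ k (e a)
  go ℕ.≤′-refl = ℤₚ.≤-refl
  go (ℕ.≤′-step h) = ℤₚ.≤-trans (Λ-e-step k _) (go h)

ℓ : ℕ → ℕ → ℤ
ℓ k m = Λ k (ψ m)

ℓ-p : ∀ k m → ℓ k (p m) ≡ ℓ (suc k) m
ℓ-p k m = cong (Λ k) (ψ-p m)

ℓ-suc : ∀ k m → ℓ k (suc m) ≡ ℓ k m + Λ k (e (qℕ m))
ℓ-suc k m = trans (cong (Λ k) (ψ-suc m)) (Λ-⊕ k (ψ m) (e (qℕ m)))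

ℓ-suc-≤ : ∀ k m {a} → a ≤ qℕ m → ℓ k (suc m) ≤ᶻ ℓ k m + Λ k (e a)
ℓ-suc-≤ k m h = subst (_≤ᶻ ℓ k m + Λ k (e _)) (sym (ℓ-suc k m)) (ℤₚ.+-monoʳ-≤ (ℓ k m) (Λ-e-antitone k h))

ℓ-mono : ∀ k {m n} → m ≤ n → ℓ k m ≤ᶻ ℓ k n
ℓ-mono k {m} m≤n = go (ℕₚ.≤⇒≤′ m≤n)
  where
  e-nonneg : ∀ a → a ≤ 3 → + 0 ≤ᶻ Λ k (e a)
  e-nonneg a a≤3 = subst (_≤ᶻ Λ k (e a)) (Λ-0⁴ k) (Λ-e-antitone k (ℕₚ.m≤n⇒m≤1+n a≤3))
  go : ∀ {n} → m ℕ.≤′ n → ℓ k m ≤ᶻ ℓ k n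
  go ℕ.≤′-refl = ℤₚ.≤-refl
  go {suc n} (ℕ.≤′-step h) = ℤₚ.≤-trans (go h)
    (subst₂ _≤ᶻ_ (ℤₚ.+-identityʳ _) (sym (ℓ-suc k n)) (ℤₚ.+-monoʳ-≤ (ℓ k n) (e-nonneg (qℕ n) (ℕ.s≤s⁻¹ (toℕ<n (q n))))))

-- In both cases no triple of positions descending from (i, j, n) can satisfy j = i + n.
Above Below : ℕ → ℕ → ℕ → Set
Above i j n = ∀ k → ℓ k (suc i) + ℓ k (suc n) ≤ᶻ ℓ k j
Below i j n = ∀ k → ℓ k (suc j) ≤ᶻ ℓ k i + ℓ k n

module _ {i j n i′ j′ n′ d d′ f} (ci : Child i d i′) (cj : Child j d′ j′) (cn : Child n f n′) where

  private
    upper : ∀ k {m d x} → Child m d x → ℓ k (suc x) ≤ᶻ ℓ (suc k) (suc m)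
    upper k {m} {x = x} c = subst (ℓ k (suc x) ≤ᶻ_) (ℓ-p k (suc m)) (ℓ-mono k (child-suc-≤ c))

    lower : ∀ k {m d x} → Child m d x → ℓ (suc k) m ≤ᶻ ℓ k x
    lower k {m} {x = x} c = subst (_≤ᶻ ℓ k x) (ℓ-p k m) (ℓ-mono k (p-≤ c))

  -- A child x of m satisfies p(m) ≤ x < p(m + 1), so the inequality for the children at level k
  -- follows from that for the parents at level k + 1. This shift is the reason to quantify over all
  -- k.
  Above-child : Above i j n → Above i′ j′ n′
  Above-child h k = ℤₚ.≤-trans (ℤₚ.+-mono-≤ (upper k ci) (upper k cn)) (ℤₚ.≤-trans (h (suc k)) (lower k cj))

  Below-child : Below i j n → Below i′ j′ n′
  Below-child h k = ℤₚ.≤-trans (upper k cj) (ℤₚ.≤-trans (h (suc k)) (ℤₚ.+-mono-≤ (lower k ci) (lower k cn)))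

ℓ₀ : ∀ m → ℓ 0 m ≡ + m
ℓ₀ = total-ψ

¬Above : ∀ i n → ¬ Above i (i ℕ.+ n) n
¬Above i n h = ℕₚ.<⇒≱ (ℕₚ.+-mono-<-≤ (ℕₚ.n<1+n i) (ℕₚ.n≤1+n n))
  (ℤₚ.drop‿+≤+ (subst₂ _≤ᶻ_ (cong₂ _+_ (ℓ₀ (suc i)) (ℓ₀ (suc n))) (ℓ₀ (i ℕ.+ n)) (h 0)))

¬Below : ∀ i n → ¬ Below i (i ℕ.+ n) n
¬Below i n h = ℕₚ.<-irrefl refl (ℤₚ.drop‿+≤+ (subst₂ _≤ᶻ_ (ℓ₀ (suc (i ℕ.+ n))) (cong₂ _+_ (ℓ₀ i) (ℓ₀ n)) (h 0)))

-- Finite tests for hopeless triples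

mutual

  -- Splitting on the sign of each length forces its evaluation before it is reused.
  nonnegative : ℕ → ℤ⁴ → Bool
  nonnegative zero v = true
  nonnegative (suc k) v = nonnegative′ k (total v) v

  nonnegative′ : ℕ → ℤ → ℤ⁴ → Bool
  nonnegative′ k (+ n) v = nonnegative k ⟨ + n , x₀ v , x₁ v , x₂ v ⟩
  nonnegative′ k -[1+ _ ] v = false

nonnegative-sound : ∀ k v → T (nonnegative (suc k) v) → + 0 ≤ᶻ Λ 0 v × T (nonnegative k (M (+ 0) v))
nonnegative-sound k v h with total v
... | + n rewrite ℕₚ.+-identityʳ n = +≤+ z≤n , h

nonnegative-Λ : ∀ k v → T (nonnegative k v) → ∀ {m} → m < k → + 0 ≤ᶻ Λ m v
nonnegative-Λ (suc k) v h {zero} _ = proj₁ (nonnegative-sound k v h)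
nonnegative-Λ (suc k) v h {suc m} (s≤s m<k) = nonnegative-Λ k (M (+ 0) v) (proj₂ (nonnegative-sound k v h)) m<k

positive : ℤ⁴ → Bool
positive = nonnegative 4

positive-sound : ∀ v → T (positive v) → ∀ k → + 0 ≤ᶻ Λ k v
positive-sound v h = Λ-nonneg v (at {0} (ℕₚ.m≤m+n 1 3)) (at {1} (ℕₚ.m≤m+n 2 2)) (at {2} (ℕₚ.m≤m+n 3 1)) (at {3} (ℕₚ.m≤m+n 4 0))
  where
  at : ∀ {m} → m < 4 → + 0 ≤ᶻ Λ m v
  at = nonnegative-Λ 4 v h

Λ-⊝-cancel : ∀ k u v → Λ k (u ⊝ v) + Λ k v ≡ Λ k u
Λ-⊝-cancel k u v = trans (sym (Λ-⊕ k (u ⊝ v) v)) (cong (Λ k) (⊝-⊕ u v))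

Λ-≤ : ∀ u v → T (positive (u ⊝ v)) → ∀ k → Λ k v ≤ᶻ Λ k u
Λ-≤ u v h k = subst₂ _≤ᶻ_ (ℤₚ.+-identityˡ _) (Λ-⊝-cancel k u v) (ℤₚ.+-monoˡ-≤ (Λ k v) (positive-sound (u ⊝ v) h k))

Λ-δ : ∀ k i j n → Λ k (δ i j n) + (ℓ k i + ℓ k n) ≡ ℓ k j
Λ-δ k i j n = trans (eq (Λ k (δ i j n)) (ℓ k i) (ℓ k n))
  (trans (cong (_+ ℓ k i) (Λ-⊝-cancel k (ψ j ⊝ ψ i) (ψ n))) (Λ-⊝-cancel k (ψ j) (ψ i)))
  where
  eq : ∀ a b c → a + (b + c) ≡ a + c + b
  eq = solve-∀

-- Smaller letters have longer images, so replacing the letter at i by its lower bound a and the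
-- letter at n by 0 only enlarges the side that has to stay small.
Above-sound : ∀ {a} i j n → a ≤ qℕ i → T (positive (δ i j n ⊝ (e a ⊕ e 0))) → Above i j n
Above-sound {a} i j n a≤ h k = ℤₚ.≤-trans (ℤₚ.+-mono-≤ (ℓ-suc-≤ k i a≤) (ℓ-suc-≤ k n z≤n))
  (subst₂ _≤ᶻ_ (trans (cong (_+ (ℓ k i + ℓ k n)) (Λ-⊕ k (e a) (e 0))) (eq (Λ k (e a)) (Λ k (e 0)) (ℓ k i) (ℓ k n)))
    (Λ-δ k i j n) (ℤₚ.+-monoˡ-≤ (ℓ k i + ℓ k n) (Λ-≤ (δ i j n) (e a ⊕ e 0) h k)))
  where
  eq : ∀ a b c d → a + b + (c + d) ≡ c + a + (d + b)
  eq = solve-∀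

Below-sound : ∀ {b} i j n → b ≤ qℕ j → T (positive (0⁴ ⊝ (δ i j n ⊕ e b))) → Below i j n
Below-sound {b} i j n b≤ h k = ℤₚ.≤-trans (ℓ-suc-≤ k j b≤)
  (subst₂ _≤ᶻ_ (trans (cong (_+ (ℓ k i + ℓ k n)) (Λ-⊕ k (δ i j n) (e b)))
                     (trans (eq (Λ k (δ i j n)) (Λ k (e b)) (ℓ k i + ℓ k n)) (cong (_+ Λ k (e b)) (Λ-δ k i j n))))
    (trans (cong (_+ (ℓ k i + ℓ k n)) (Λ-0⁴ k)) (ℤₚ.+-identityˡ _))
    (ℤₚ.+-monoˡ-≤ (ℓ k i + ℓ k n) (Λ-≤ 0⁴ (δ i j n ⊕ e b) h k)))
  where
  eq : ∀ a b c → a + b + c ≡ a + c + b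
  eq = solve-∀

-- A triple (letter at i, letter at j, δ i j n).  A smaller letter allows every continuation that a larger one
-- does, so letters are bounds: an element stands for all those that lie above it in the order _≼_.
record Element : Set where
  constructor el
  field
    a b : ℕ
    D : ℤ⁴
open Element

-- The order on elements and sets of minimal elements

eqℤ : ℤ → ℤ → Bool
eqℤ (+ m) (+ n) = m ≡ᵇ n
eqℤ -[1+ m ] -[1+ n ] = m ≡ᵇ n
eqℤ _ _ = false

eqℤ-sound : ∀ x y → T (eqℤ x y) → x ≡ y
eqℤ-sound (+ m) (+ n) h = cong +_ (ℕₚ.≡ᵇ⇒≡ m n h)
eqℤ-sound -[1+ m ] -[1+ n ] h = cong -[1+_] (ℕₚ.≡ᵇ⇒≡ m n h)

_≼_ : Element → Element → Set
u ≼ v = D u ≡ D v × a u ≤ a v × b u ≤ b v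

_≼ᵇ_ : Element → Element → Bool
el a b ⟨ x , y , z , w ⟩ ≼ᵇ el a′ b′ ⟨ x′ , y′ , z′ , w′ ⟩ =
  eqℤ x x′ ∧ eqℤ y y′ ∧ eqℤ z z′ ∧ eqℤ w w′ ∧ (a ≤ᵇ a′) ∧ (b ≤ᵇ b′)

∧-elim : ∀ {x y} → T (x ∧ y) → T x × T y
∧-elim = Equivalence.to T-∧

≼ᵇ-sound : ∀ u v → T (u ≼ᵇ v) → u ≼ v
≼ᵇ-sound u v h with ∧-elim h
... | hx , h₁ with ∧-elim h₁
... | hy , h₂ with ∧-elim h₂
... | hz , h₃ with ∧-elim h₃
... | hw , h₄ with ∧-elim h₄
... | ha , hb = ⟨⟩-cong (eqℤ-sound _ _ hx) (eqℤ-sound _ _ hy) (eqℤ-sound _ _ hz) (eqℤ-sound _ _ hw)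
  , ℕₚ.≤ᵇ⇒≤ _ _ ha , ℕₚ.≤ᵇ⇒≤ _ _ hb

≼-refl : ∀ {u} → u ≼ u
≼-refl = refl , ℕₚ.≤-refl , ℕₚ.≤-refl

≼-trans : ∀ {u v w} → u ≼ v → v ≼ w → u ≼ w
≼-trans (p , q , r) (p′ , q′ , r′) = trans p p′ , ℕₚ.≤-trans q q′ , ℕₚ.≤-trans r r′

_⊑_ : List Element → List Element → Set
A ⊑ B = ∀ {v} → v ∈ A → ∃ λ u → u ∈ B × u ≼ v

_⊑ᵇ_ : List Element → List Element → Bool
A ⊑ᵇ B = all (λ v → any (_≼ᵇ v) B) A

⊑ᵇ-sound : ∀ A B → T (A ⊑ᵇ B) → A ⊑ B
⊑ᵇ-sound A B h {v} v∈A with find (any⁻ (_≼ᵇ v) B (All.lookup (all⁺ (λ v → any (_≼ᵇ v) B) A h) v∈A))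
... | u , u∈B , u≼v = u , u∈B , ≼ᵇ-sound u v u≼v

⊆⇒⊑ : ∀ {A B} → (∀ {v} → v ∈ A → v ∈ B) → A ⊑ B
⊆⇒⊑ h v∈A = _ , h v∈A , ≼-refl

insert : Element → List Element → List Element
insert v L = if any (_≼ᵇ v) L then L else v ∷ filterᵇ (λ u → not (v ≼ᵇ u)) L

minimals : List Element → List Element
minimals = foldr insert []

insert-⊆ : ∀ v L {u} → u ∈ insert v L → u ∈ v ∷ L
insert-⊆ v L u∈ with any (_≼ᵇ v) L
... | true = there u∈
insert-⊆ v L (here eq) | false = here eq
insert-⊆ v L (there u∈) | false = there (proj₁ (∈-filter⁻ (T? ∘ λ u → not (v ≼ᵇ u)) u∈))

T-not : ∀ {x} → ¬ T x → T (not x)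
T-not {true} h = h tt
T-not {false} h = tt

insert-⊒ : ∀ v L → (v ∷ L) ⊑ insert v L
insert-⊒ v L u∈ with any (_≼ᵇ v) L in eq
insert-⊒ v L (here refl) | true with find (any⁻ (_≼ᵇ v) L (subst T (sym eq) tt))
... | u , u∈ , h = u , u∈ , ≼ᵇ-sound u v h
insert-⊒ v L (there u∈) | true = _ , u∈ , ≼-refl
insert-⊒ v L (here refl) | false = v , here refl , ≼-refl
insert-⊒ v L {u} (there u∈) | false with T? (v ≼ᵇ u)
... | yes h = v , here refl , ≼ᵇ-sound v u h
... | no h = u , there (∈-filter⁺ (T? ∘ λ u → not (v ≼ᵇ u)) u∈ (T-not h)) , ≼-refl

minimals-⊆ : ∀ L {u} → u ∈ minimals L → u ∈ L
minimals-⊆ (v ∷ L) u∈ with insert-⊆ v (minimals L) u∈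
... | here eq = here eq
... | there u∈′ = there (minimals-⊆ L u∈′)

minimals-⊒ : ∀ L → L ⊑ minimals L
minimals-⊒ (v ∷ L) (here refl) = insert-⊒ v (minimals L) (here refl)
minimals-⊒ (v ∷ L) (there u∈) with minimals-⊒ L u∈
... | w , w∈ , w≼u with insert-⊒ v (minimals L) (there w∈)
... | x , x∈ , x≼w = x , x∈ , ≼-trans x≼w w≼u

-- Appending a digit to n: the transition between sets

branches : ℕ → List (ℕ × ℕ)
branches a = (0 , 0) ∷ (if a <ᵇ 3 then (1 , suc a) ∷ [] else [])

kid : ℕ → ℤ⁴ → ℕ × ℕ → ℕ × ℕ → Element
kid f D (d , a′) (d′ , b′) = el a′ b′ (M (+ d′ - + d - + f) D)

kids : ℕ → Element → List Element
kids f u = concatMap (λ s → map (kid f (D u) s) (branches (b u))) (branches (a u))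

-- Conservative for Above, as it takes the letter 0 for the unknown letter at n.
alive : Element → Bool
alive (el a b D) = not (positive (D ⊝ (e a ⊕ e 0)) ∨ positive (0⁴ ⊝ (D ⊕ e b)))

next : ℕ → List Element → List Element
next f S = filterᵇ alive (concatMap (kids f) S)

step : ℕ → List Element → List Element
step f S = minimals (next f S)

branch-complete : ∀ {i d i′ a} → Child i d i′ → a ≤ qℕ i → ∃ λ a′ → (d , a′) ∈ branches a × a′ ≤ qℕ i′
branch-complete first h = 0 , here refl , z≤n
branch-complete {i} {a = a} (second q<3) h with a <ᵇ 3 in eq
... | true = suc a , there (here refl) , subst (suc a ≤_) (sym (q-second i q<3)) (s≤s h)
... | false = ⊥-elim (subst T eq (ℕₚ.<⇒<ᵇ (ℕₚ.≤-<-trans h q<3)))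

branch-sound : ∀ i {d a a′} → (d , a′) ∈ branches a → qℕ i ≤ a → ∃ λ i′ → Child i d i′ × qℕ i′ ≤ a′
branch-sound i (here refl) h = p i , first , ℕₚ.≤-reflexive (q-first i)
branch-sound i {a = a} (there x) h with a <ᵇ 3 in eq
branch-sound i {a = a} (there (here refl)) h | true =
  let q<3 = ℕₚ.≤-<-trans h (ℕₚ.<ᵇ⇒< a 3 (subst T (sym eq) tt))
  in suc (p i) , second q<3 , subst (_≤ suc a) (sym (q-second i q<3)) (s≤s h)

-- The actual letters may be smaller than those of u: the pair (i, j) then has every continuation
-- that u promises. `Covered` uses the opposite direction, where u must have every continuation of
-- the actual pair.
record Realised (n : ℕ) (u : Element) : Set where
  constructor realised
  field
    i j : ℕ
    i-letter : qℕ i ≤ a u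
    j-letter : qℕ j ≤ b u
    difference : δ i j n ≡ D u

record Under (n : ℕ) (S : List Element) : Set where
  constructor mkUnder
  field realise : ∀ {u} → u ∈ S → Realised n u
open Under

Covered : List Element → ℕ → ℕ → ℕ → Set
Covered S i j n = ∃ λ u → u ∈ S × u ≼ el (qℕ i) (qℕ j) (δ i j n)

record Over (n : ℕ) (S : List Element) : Set where
  constructor mkOver
  field cover : ∀ i j → ¬ Above i j n → ¬ Below i j n → Covered S i j n
open Over

-- Passing to larger letters keeps an element realised, so `Under` moves down along `_⊑_` while
-- `Over` moves up.
Under-⊑ : ∀ {n A B} → A ⊑ B → Under n B → Under n A
Under-⊑ {n} {A} A⊑B U = mkUnder go
  where
  go : ∀ {v} → v ∈ A → Realised n v
  go v∈A with A⊑B v∈A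
  ... | u , u∈B , eq , ha , hb with realise U u∈B
  ... | realised i j hi hj δ≡ = realised i j (ℕₚ.≤-trans hi ha) (ℕₚ.≤-trans hj hb) (trans δ≡ eq)

Covered-⊑ : ∀ {A B} i j n → A ⊑ B → Covered A i j n → Covered B i j n
Covered-⊑ i j n A⊑B (u , u∈A , u≼) with A⊑B u∈A
... | w , w∈B , w≼u = w , w∈B , ≼-trans w≼u u≼

Over-⊑ : ∀ {n A B} → A ⊑ B → Over n A → Over n B
Over-⊑ {n} A⊑B O = mkOver λ i j ¬A ¬B → Covered-⊑ i j n A⊑B (cover O i j ¬A ¬B)

kid-∈ : ∀ f {u s t} → s ∈ branches (a u) → t ∈ branches (b u) → kid f (D u) s t ∈ kids f u
kid-∈ f {u} {s} s∈ t∈ = ∈-concatMap⁺ (λ s → map (kid f (D u) s) (branches (b u))) (lose s∈ (∈-map⁺ (kid f (D u) s) t∈))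

kids-∈ : ∀ f {u v} → v ∈ kids f u → ∃ λ s → ∃ λ t → s ∈ branches (a u) × t ∈ branches (b u) × v ≡ kid f (D u) s t
kids-∈ f {u} v∈ with find (∈-concatMap⁻ (λ s → map (kid f (D u) s) (branches (b u))) v∈)
... | s , s∈ , v∈′ with ∈-map⁻ (kid f (D u) s) v∈′
... | t , t∈ , eq = s , t , s∈ , t∈ , eq

Under-next : ∀ {n f n′ S} → Child n f n′ → Under n S → Under n′ (next f S)
Under-next {n} {f} {n′} {S} cn U = mkUnder go
  where
  go : ∀ {v} → v ∈ next f S → Realised n′ v
  go v∈ with find (∈-concatMap⁻ (kids f) (proj₁ (∈-filter⁻ (T? ∘ alive) v∈)))
  ... | u , u∈ , v∈′ with kids-∈ f v∈′ | realise U u∈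
  ... | s , t , s∈ , t∈ , refl | realised i j hi hj δ≡ with branch-sound i s∈ hi | branch-sound j t∈ hj
  ... | i′ , ci , hi′ | j′ , cj , hj′ = realised i′ j′ hi′ hj′ (trans (δ-child ci cj cn) (cong (M (+ proj₁ t - + proj₁ s - + f)) δ≡))

alive-complete : ∀ {u} i j n → u ≼ el (qℕ i) (qℕ j) (δ i j n) → ¬ Above i j n → ¬ Below i j n → T (alive u)
alive-complete {el a b .(δ i j n)} i j n (refl , ha , hb) ¬A ¬B = T-not (dead ∘ Equivalence.to T-∨)
  where
  dead : T (positive (δ i j n ⊝ (e a ⊕ e 0))) ⊎ T (positive (0⁴ ⊝ (δ i j n ⊕ e b))) → ⊥
  dead (inj₁ h) = ¬A (Above-sound i j n ha h)
  dead (inj₂ h) = ¬B (Below-sound i j n hb h)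

Covered-next : ∀ {i j n i′ j′ n′ d d′ f S} → Child i d i′ → Child j d′ j′ → Child n f n′
  → ¬ Above i′ j′ n′ → ¬ Below i′ j′ n′ → Covered S i j n → Covered (next f S) i′ j′ n′
Covered-next {i} {j} {n} {i′} {j′} {n′} {d} {d′} {f} ci cj cn ¬A ¬B (u , u∈ , eq , ha , hb)
  with branch-complete ci ha | branch-complete cj hb
... | a′ , s∈ , ha′ | b′ , t∈ , hb′ =
  v , ∈-filter⁺ (T? ∘ alive) (∈-concatMap⁺ (kids f) (lose u∈ (kid-∈ f {u} s∈ t∈))) (alive-complete i′ j′ n′ v≼ ¬A ¬B) , v≼
  where
  v : Element
  v = kid f (D u) (d , a′) (d′ , b′)
  v≼ : v ≼ el (qℕ i′) (qℕ j′) (δ i′ j′ n′)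
  v≼ = trans (cong (M (+ d′ - + d - + f)) eq) (sym (δ-child ci cj cn)) , ha′ , hb′

-- Every pair has a pair of parents, and hopeless parents have only hopeless children; hence a pair
-- that is still possible comes from a covered one.
Over-next : ∀ {n f n′ S} → Child n f n′ → Over n S → Over n′ (next f S)
Over-next {n} {f} {n′} {S} cn O = mkOver go
  where
  go : ∀ i j → ¬ Above i j n′ → ¬ Below i j n′ → Covered (next f S) i j n′
  go i′ j′ ¬A ¬B with parent i′ | parent j′
  ... | i , _ , ci | j , _ , cj = Covered-next ci cj cn ¬A ¬B
    (cover O i j (¬A ∘ Above-child ci cj cn) (¬B ∘ Below-child ci cj cn))

record Exact (n : ℕ) (S : List Element) : Set where
  constructor exact
  field
    under : Under n S
    over : Over n S
open Exact public

Exact-step : ∀ {n f n′ S} → Child n f n′ → Exact n S → Exact n′ (step f S)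
Exact-step {f = f} {S = S} c (exact U O) = exact (Under-⊑ (⊆⇒⊑ (minimals-⊆ (next f S))) (Under-next c U))
  (Over-⊑ (minimals-⊒ (next f S)) (Over-next c O))

-- One inclusion transports `Over`, the reverse one `Under`.
Exact-≈ : ∀ {n} A B → T (A ⊑ᵇ B ∧ B ⊑ᵇ A) → Exact n A → Exact n B
Exact-≈ A B h (exact U O) = exact (Under-⊑ (⊑ᵇ-sound B A (proj₂ (∧-elim h))) U) (Over-⊑ (⊑ᵇ-sound A B (proj₁ (∧-elim h))) O)

-- Differences with j = i + n

_≟⁴_ : (u v : ℤ⁴) → Dec (u ≡ v)
u ≟⁴ v = map′ (λ (p , q , r , s) → ⟨⟩-cong p q r s) (λ eq → cong x₀ eq , cong x₁ eq , cong x₂ eq , cong x₃ eq)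
  ((x₀ u ℤₚ.≟ x₀ v) ×-dec (x₁ u ℤₚ.≟ x₁ v) ×-dec (x₂ u ℤₚ.≟ x₂ v) ×-dec (x₃ u ℤₚ.≟ x₃ v))

balanced? : ∀ v → Dec (total v ≡ + 0)
balanced? v = total v ℤₚ.≟ + 0

-- Elements with different letters can share one difference, hence the deduplication. Total 0
-- expresses j = i + n, see `balanced⇒≡`.
zeros : List Element → List ℤ⁴
zeros S = deduplicate _≟⁴_ (filter balanced? (map D S))

zeros-unique : ∀ S → Unique (zeros S)
zeros-unique S = Dedup.deduplicate-! _≟⁴_ (filter balanced? (map D S))

∈-zeros⁻ : ∀ {S v} → v ∈ zeros S → total v ≡ + 0 × ∃ λ u → u ∈ S × v ≡ D u
∈-zeros⁻ {S} v∈ with ∈-filter⁻ balanced? (∈-deduplicate⁻ _≟⁴_ (filter balanced? (map D S)) v∈)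
... | v∈′ , eq = eq , ∈-map⁻ D v∈′

∈-zeros⁺ : ∀ {S u} → u ∈ S → total (D u) ≡ + 0 → D u ∈ zeros S
∈-zeros⁺ u∈ eq = ∈-deduplicate⁺ _≟⁴_ (∈-filter⁺ balanced? (∈-map⁺ D u∈) eq)

-- Counting Parikh vectors

Unique-⊆-length : ∀ {A : Set} {xs ys : List A} → Unique xs → (∀ {x} → x ∈ xs → x ∈ ys) → length xs ≤ length ys
Unique-⊆-length {xs = []} _ _ = z≤n
Unique-⊆-length {xs = x ∷ xs} (x∉ ∷ xs!) h with ∈-∃++ (h (here refl))
... | us , vs , refl = subst (suc (length xs) ≤_)
  (sym (trans (length-++ us) (trans (ℕₚ.+-suc (length us) (length vs)) (cong suc (sym (length-++ us))))))
  (s≤s (Unique-⊆-length xs! λ y∈ → drop (λ eq → All.lookup x∉ y∈ (sym eq)) (h (there y∈))))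
  where
  drop : ∀ {y} → y ≢ x → y ∈ us ++ x ∷ vs → y ∈ us ++ vs
  drop y≢x y∈ with ∈-++⁻ us y∈
  ... | inj₁ y∈us = ∈-++⁺ˡ y∈us
  ... | inj₂ (here eq) = ⊥-elim (y≢x eq)
  ... | inj₂ (there y∈vs) = ∈-++⁺ʳ us y∈vs

fromParikh : Vec ℕ 4 → ℤ⁴
fromParikh (x ∷ y ∷ z ∷ w ∷ []) = ⟨ + x , + y , + z , + w ⟩

fromParikh-injective : ∀ {u v} → fromParikh u ≡ fromParikh v → u ≡ v
fromParikh-injective {_ ∷ _ ∷ _ ∷ _ ∷ []} {_ ∷ _ ∷ _ ∷ _ ∷ []} refl = refl

offset : ℕ → Vec ℕ 4 → ℤ⁴
offset n v = fromParikh v ⊝ ψ n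

offset-injective : ∀ n {u v} → offset n u ≡ offset n v → u ≡ v
offset-injective n {u} {v} eq = fromParikh-injective
  (trans (sym (⊝-⊕ (fromParikh u) (ψ n))) (trans (cong (_⊕ ψ n) eq) (⊝-⊕ (fromParikh v) (ψ n))))

offset-factor : ∀ i n → offset n (parikh (factor i n)) ≡ δ i (i ℕ.+ n) n
offset-factor i n = cong (_⊝ ψ n) (trans (sym (eq⁴ (ψ i) (toℤ⁴ (factor i n))))
  (cong (_⊝ ψ i) (sym (trans (cong toℤ⁴ (applyUpTo-+ q i n)) (toℤ⁴-++ (pre i) (factor i n))))))
  where
  eq : ∀ a b → a + b - a ≡ b
  eq = solve-∀
  eq⁴ : ∀ u v → u ⊕ v ⊝ u ≡ v
  eq⁴ u v = ⟨⟩-cong (eq (x₀ u) (x₀ v)) (eq (x₁ u) (x₁ v)) (eq (x₂ u) (x₂ v)) (eq (x₃ u) (x₃ v))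

total-δ : ∀ i j n → total (δ i j n) + (+ i + + n) ≡ + j
total-δ i j n = subst₂ _≡_ (cong (λ m → total (δ i j n) + m) (cong₂ _+_ (ℓ₀ i) (ℓ₀ n))) (ℓ₀ j) (Λ-δ 0 i j n)

total-δ-zero : ∀ i n → total (δ i (i ℕ.+ n) n) ≡ + 0
total-δ-zero i n = trans (sym (eq (total (δ i (i ℕ.+ n) n)) (+ i + + n)))
  (trans (cong (_- (+ i + + n)) (total-δ i (i ℕ.+ n) n)) (ℤₚ.+-inverseʳ (+ (i ℕ.+ n))))
  where
  eq : ∀ a b → a + b - b ≡ a
  eq = solve-∀

balanced⇒≡ : ∀ i j n → total (δ i j n) ≡ + 0 → j ≡ i ℕ.+ n
balanced⇒≡ i j n eq = ℤₚ.+-injective (trans (sym (total-δ i j n)) (trans (cong (_+ (+ i + + n)) eq) (ℤₚ.+-identityˡ _)))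

balanced-factor : ∀ {n u} → Realised n u → total (D u) ≡ + 0 → ∃ λ i → offset n (parikh (factor i n)) ≡ D u
balanced-factor {n} (realised i j _ _ δ≡) bal = i , trans (offset-factor i n)
  (trans (cong (λ j → δ i j n) (sym (balanced⇒≡ i j n (trans (cong total δ≡) bal)))) δ≡)

Under-zeros : ∀ {n S v} → Under n S → v ∈ zeros S → ∃ λ i → offset n (parikh (factor i n)) ≡ v
Under-zeros {n} {S} {v} U v∈ = go (∈-zeros⁻ {S} v∈)
  where
  go : (total v ≡ + 0 × ∃ λ u → u ∈ S × v ≡ D u) → ∃ λ i → offset n (parikh (factor i n)) ≡ v
  go (bal , u , u∈ , refl) = balanced-factor (realise U u∈) bal

Over-zeros : ∀ {n S} → Over n S → ∀ i → offset n (parikh (factor i n)) ∈ zeros S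
Over-zeros {n} {S} O i with cover O i (i ℕ.+ n) (¬Above i n) (¬Below i n)
... | u , u∈ , eq , _ = subst (_∈ zeros S) (trans eq (sym (offset-factor i n)))
  (∈-zeros⁺ u∈ (trans (cong total eq) (total-δ-zero i n)))

Under-≤ : ∀ {n S c} → Under n S → AbComplexity n c → length (zeros S) ≤ c
Under-≤ {n} {S} U (L , refl , _ , complete , _) = subst (length (zeros S) ≤_) (length-map (offset n) L)
  (Unique-⊆-length (zeros-unique S) λ v∈ → let (i , eq) = Under-zeros U v∈ in
    subst (_∈ map (offset n) L) eq (∈-map⁺ (offset n) (complete i)))

Over-≥ : ∀ {n S c} → Over n S → AbComplexity n c → c ≤ length (zeros S)
Over-≥ {n} {S} O (L , refl , L! , _ , sound) = subst (_≤ length (zeros S)) (length-map (offset n) L)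
  (Unique-⊆-length (Uniqueₚ.map⁺ (offset-injective n) L!) mem)
  where
  mem : ∀ {x} → x ∈ map (offset n) L → x ∈ zeros S
  mem x∈ with ∈-map⁻ (offset n) x∈
  ... | v , v∈ , refl with All.lookup sound v∈
  ... | i , refl = Over-zeros O i

Exact-≡ : ∀ {n S c} → Exact n S → AbComplexity n c → c ≡ length (zeros S)
Exact-≡ E ab = ℕₚ.≤-antisym (Over-≥ (over E) ab) (Under-≤ (under E) ab)

Exact⇒AbComplexity : ∀ {n S} → Exact n S → AbComplexity n (length (zeros S))
Exact⇒AbComplexity {n} {S} (exact U O) with lift (zeros S) (λ v∈ → Under-zeros U v∈)
  where
  -- An arbitrary integer vector need not be the offset of a Parikh vector; the preimages are
  -- supplied by the factors that realise the differences.
  lift : ∀ zs → (∀ {v} → v ∈ zs → ∃ λ i → offset n (parikh (factor i n)) ≡ v)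
    → ∃ λ L → map (offset n) L ≡ zs × All (λ v → ∃ λ i → parikh (factor i n) ≡ v) L
  lift [] h = [] , refl , []
  lift (z ∷ zs) h with h (here refl) | lift zs (h ∘ there)
  ... | i , eq | L , eqs , ps = _ ∷ L , cong₂ _∷_ eq eqs , (i , refl) ∷ ps
... | L , eqs , ps = L , trans (sym (length-map (offset n) L)) (cong length eqs)
  , Uniqueₚ.map⁻ (subst Unique (sym eqs) (zeros-unique S)) , complete , ps
  where
  complete : ∀ i → parikh (factor i n) ∈ L
  complete i = go (∈-map⁻ (offset n) (subst (offset n (parikh (factor i n)) ∈_) (sym eqs) (Over-zeros O i)))
    where
    go : (∃ λ v → v ∈ L × offset n (parikh (factor i n)) ≡ offset n v) → parikh (factor i n) ∈ L
    go (v , v∈ , eq) = subst (_∈ L) (sym (offset-injective n {parikh (factor i n)} {v} eq)) v∈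

-- A set is written as a numeral with four decimal digits per element; the coordinates of δ lie in {-2, …, 2}
-- and are stored in base 5 with offset 2.
decodeElement : ℕ → Element
decodeElement c = el (c / 2500) (c / 625 % 4) ⟨ coord 125 , coord 25 , coord 5 , coord 1 ⟩
  where
  coord : (m : ℕ) → .{{ℕ.NonZero m}} → ℤ
  coord m = + (c / m % 5) - + 2

decode : ℕ → ℕ → List Element
decode zero _ = []
decode (suc fuel) zero = []
decode (suc fuel) n@(suc _) = decodeElement (n % 10000) ∷ decode fuel (n / 10000)

-- The two closed families and their verification

upperCodes : List ℕ
upperCodes =
  168017201880191019202110212021602880292029303120313031603170318032103220332033603370338034103420437043804420462091609220932093610381042104310661558170717112591269326972707271327175196 ∷
  2840287028802890292029303070308031103120313031603170413041404170418043304340437043804420457045804620893091610331034103710571066116311671183231126682688269126922809281428182832283328372838284128427664 ∷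
  16401680184018801910192020702080211021202160288028902920293030803090312031303140316031703180332033303360337033803410342043804420458046209090916093209361038103910421043105810591062106617071711259126892693271327172834 ∷
  20702110287028803070308031103120313031603170331033203330336033704320433043604370438044104420456045704580461046210321033103610371038105611821183118616781831268827082712283828412842285728612862519151925318 ∷
  18801910192020702080211021203070308031103120313031603170318033103320333033603370338034103420361043704380442045704580461046209130916091710571058106110661706221027132716271727362857285851937814 ∷
  19102870288029102920293030703080311031203130316031704120413041404170418043204330436043704380441044204570458046104620893103210331036104111621163116711821183118616812668268826922818283228332836283728382841284253227789 ∷
  1680188019101920207020802110212028702880292029303070308031103120313031403160317031803320333033603370338034103420437043804410442045704580461046209161037103810421043105710581061269327132716271728572858286253227689 ∷
  19102070211028702880291029203070311031203130316031703310332033503360337034104370438044104420457046104621037103810411042105710611706233526882692271227162838284228612862531853215322 ∷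
  1880191019201960207021102120215021602170311031203130316031703180321032203310332033603370338034003410342034603610362043704380441044204610462091309160917093209401061109015851706170725912592271327212736273727412865507151935197 ∷
  191019202870288029102920293029703070308031103120313031603170336033703410413041704180437043804410442046104621037104110471061116311671682168326882711271227162818282228382842516851725321 ∷
  18801910192020702080211021203070308031203130314031603170318033203330336033703380341034203570361036204370438044204570458046209130917093610571058106610861581271327162717273227362737285851937689 ∷
  19102870288029102920293030703080311031203130316031703320336033704120413041404170418043204330436043704380441044204570458046104621032103310361041116211631167118211831186168126882692270727112712281828332838284128425168532153227789 ∷
  1680188019101920207021102120287028802920293030803120313031603170318032103320333033603370338034103420437043804420458046209160932093610371038104210431058106617071711269327082713271627172862519653227814 ∷
  1640168018801910192020702080211021202870288028902920293030703080312031303140316031703180322033203330336033703380341034204370438044204570458046209160936103710381039104210431057105810661711268926932713271627175197 ∷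
  164016801880191019201930207020802110212021602170293031203130314031703180322033203330337033803410342043804420462091309140917093209330941104310621586170717082568259125922689271327185197 ∷
  16801880191019202680287028802890292029302970307030803120313031603170318033703410413041404170418041904220437043804420462088909161018103710661163116715611682168326642693271227162814282228382842517252945298 ∷
  1640168017201880191019201930212021602880289029202930294029702980312031303140317031803220337033803410342043804420462089309411038103910421043104410471062155825682591268926972713271727182819516951735198 ∷
  28402870288029202930307030803110312031303170332033303360337043304340437043804420457045804610462103310341037103810421043105710611183268826922707270827112712280928182838284251687814 ∷
  16801880192020702080211021202880307030803090312031303140317031803280332033303360337033803420433043404370438044204570458046209090917091809361038105711831703233626842693271327172834285728587689 ∷
  1910287028802910292029302960297030703080311031203130316031703360412041304160417041804210422043604370438044104420461046210361162116311661167118616811682168321902688269227112818282128222837283828412842516851715172 ∷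
  168017101720188019101920211028702880292029302970312031303160317031803210322033603370338034103420437043804420462091609210936103710381042104310471066155817112693269626972712271327162717 ∷
  2070211028702880292030703080311031203130316031703310332033303360337043204330437043804410442045704580461046209161032103310371038104210611182118317062688269126922708271228382841284228572861286253187814 ∷
  19102870288028902910292029303070308031103120313031603170332033604120413041404170418043204330437043804410442045704580461046210321033104110611162116311671182118326882692270727112814281828332837283828412842516853227664 ∷
  164016801880191019202070211021202880289029202930307030803120313031403160317031803210322033203330336033703380341034204370438044204570458046209160936103810391042104310571058106610861581268926932708271327162717286151965197 ∷
  1910268028702880291029202930307030803110312031303160317041204130414041704180422043204330437043804410442046210131017101810321033104111621163116711831686180726682688269228182837283828412842295852975298532153227789 ∷
  1680172018801910192028702880289029202930297029803070308031203130316031703180321032203370338034103420418043704380442045804620893091610371038103910421047105810661561168226932697271227132716271728142833517351967664 ∷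
  28402870288029202930307030803110312031303320336041304320433043404370438044204530457045804610462055810321033103410371042104310531061116311821677182826882707271128092817281828282833283728385168 ∷
  284028702880292029303070308031103120313033204080409041204130414041704180432043304340437043804420457045804610462055808931013103210611158115911621163116711821677167826682688270728092817281828332836283728385289 ∷
  1640168018401880207028402870288028902920293030703080309031203130314031703180332033303370338041304140418043304340437043804420457045804621033103410371042105711631183268926922693270827122713283428425322 ∷
  28702880291029203070308031103120313031603170331033203360337041204130417043204330436043704380441044204560457045804610462103210331036104110561162116311671182118311861831268826912692270727112712283328382841284253185321 ∷
  28702880291029203070308031103120315031603170336041204130417041804330436043704380441044204570461046204651033103610411057106511621163116711861681180826912692271128132832283728402841284252935321 ∷
  19101920211028702880292029303080311031203130316031703210332033603370340034103420437043804410442046104620916093209401037103810421043106116831707234026882707271227152716271728182838286151685196 ∷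
  18802070211021202840287028803070308030903110312031303170318033203330336033703380433043404370438044204570458046104620917103310341037103810571061118326842692270827132834284228572858286251935314 ∷
  18401880191019202070208021102120307030803090312031303140317031803320333033403360337033803410342035703580361036204340437043804420457045804620909091309360941105710581086157715812709271327162717273227332736273751895193 ∷
  2840287028802890292029303070308030903110312031303170332041304140417041804330434043704380442045704580462089310331034103710571163116711832311266826842688269227072814281828332837283828425164 ∷
  191028702880291029203070308031103120313031603170331033203360337034104370438044104420457045804610462103710381041104210571058106117062688269227072711271227162833283828422861531853215322 ∷
  18801910192020702080211021202160217031203130314031603170318032103220332033303360337033803410342034603570361036204370438044204620913091609170932093309361066108210831086158122102591259227132732273627372741285851935196519752217689 ∷
  28702880307030803110312031303270328033103320333033603370432043304340436043704380442045304560457045804610462103210331037103810531056118211831186170218281831268827072708271127122838285728615317531878097814 ∷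
  1840188020702080211021203070308030903120313031403170318032803320333033403360337033803570361043304340437043804420457045804620909091309361057108611831577158117032709271327322736284228585189519251935341 ∷
  284028702880289029202930307030803110312031303320336040904130414041704180432043304340437043804410442045704580461046210321033103710611159116311671182118316782688270727112809281428172818283328372838516853167664 ∷
  164016801880207021102840288028902920293030703080309031203130314031603170318033203330336033703380434043704380442045704580462093610341038103910421043105710581066171126842689269226932708271227132834284128425191 ∷
  2870307030803110312031503160317033103320335033603370433043604370438044104420456045704580461046204650916091710331037105610571065118311861710183126912692270727112712283328402841284228615313 ∷
  1910192020702110212030803110312031303160317033103320333033603370340034103420361043804420458046104620932094010581061106210661082109015851706270827152716271727362838285728655188 ∷
  287030703080311031203160317032703310332033503360337043204330436043704380441044204560457045804610462048109161033103710561182118311861206167817022335269127072711271228332841284228562857286151925313 ∷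
  188019101920207020802110212030703080311031203130316031703310332033303360337033803410342035603570361036204370438044204570458046104620481105710581061106610811577221027132716271727312732273627372858 ∷
  188019101920207021102870288029203070308031103120313031603170318033103320333033603370338034103420433043704380441044204570458046104620916103710381042105710611183170627082712271327162717285728612862519353227814 ∷
  1880191019201930207020802110212021303080312031303140317031803320333033603370338034103420357036204580462091309320936094110581062106310671082108615812588271627172718273227372858286150687689 ∷
  168018802870288028902920293030703080311031203130316031703180332033704180433043704380442045704580461046209161033103710381039104210571061106611832691269226932707271228142833283628382841284253227664 ∷
  1640168018801910192019302070212029303080312031303140317031803220332033303360337033803410342043804420458046209130914091709320936094110431058106217072336256826892708271127132716271727185197 ∷
  191019202070211021202880292030703080311031203130316031703210331033203350336033703410342043704380441044204570461046209161038104210571061168317062335268827162717283828612862519653185322 ∷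
  168017101720188019101920211028702880291029202930296029703110312031303160317031803210322033603370341034204170418042204370438044104420461046210371038104110461061116721902693269626972712271627172838 ∷
  287028803070308031103120316031703310332033503360337043204330436043704380441044204560457045804610462048105580916103210331036103710381056118211861206167716782335269127072711271228132833284128422856285728615192 ∷
  164016801840188019101920207020802110212021602880292029303120313031403160317031803210322033203330336033703380341034204370438044204620914091609320933093610381042104310661086155915811707170825912689269327132717286151965197 ∷
  19101920268028702880289029102920293029602970307030803110312031303160317041204130414041704180419042204370438044104420462101810411046116211631167168216831686266826882814281828212822283728382841284251715172529876647794 ∷
  1640168017101720188019101920212021602870288028902920293029402970298031203130314031603170318032103220337033803410342043704380442046208930916092110371038103910421043104410471066155815612591268926932696269727132717281951695173 ∷
  191021102870291029203070311031203150316031703310332033503360337034003410436043704380441044204560457046104620465103610371041104210561057106511861710183126922707271227152716284228612862532153227813 ∷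
  1910287028802910292029602970307031103120315031603170336041204130416041704180421042204360437043804410442046104620465101310171036106511621163116611671186168116822692271128132821282228372840284128425171517252937818 ∷
  1710172019101920211028702880291029203110312031303160317031803210322033603370340034103420437043804410442046104620921092209401037103810411042106123402688269626972712271527162717283828617693 ∷
  28703070308031103120313031603170331033203350336033704320433043604370438044104420456045704580461046209160917103210331037105611821183118612062335269126922707271127122833283828412842286129817688 ∷
  16801880191019201930207020802110212021302160217031203130314031603170318032203320333033603370338034103420362046209130917091809320933093610621063106610671082108310861581256825882591259227182737274128572858286151977689 ∷
  16801720188019101920193021202160293031203130316031703180321032203360337033803410342044204620913091609170922093610431062106310661711256825912697271127132717271851965198 ∷
  19101920211021502880292031103120313031603170321033103320335033603370340034103420437043804410442046104620916093209401038104210611558170617072335234026882707271227162717283828612862519653185322 ∷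
  1680171017201880191019201960211021202160292029302970312031303160317031803210322033603370338034103420346043804420462091309160921093610421043104710621066155817112571259126932697271327172721 ∷
  191019202870288029102920293030703080311031203130316031703320336033703410342041304170418043704380441044204570458046104621037104110571058106111631167268827072711271227162717281828332838516853215322 ∷
  19102870288029102920293029603070311031203130316031704120413041704180422043704380441044204610462101310171041104610611162116311671682268826922818282128362837284128425168517152975322 ∷
  287028802910292029303070308031103120313031603170412041304140416041704180432043304360437043804410442045704610462101310321033103611621163116611671182118311861681268826912692281828322836283728412842295851687789 ∷
  1680188019101920287028802890292029303070308031103120313031603170318033203360337034103420418043704380442045704580461046209161037103810391042105710581061106626932707271127122716271728142833283853227664 ∷
  164016801880191019202070211021202160217029303120313031403160317031803220332033303360337033803410342036103620438044204620913091409160917093209330936104310621066108615811707170822102591259226892693270827132736273727415197 ∷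
  1640168018401880192020702080212028802890293030803090312031303140317031803320333033403370338034204380442045804620909091709321038103910431058105910621707268926932709271327172858 ∷
  1910287028802890291029202930307030803110312031303160317041204130414041704180432043304360437043804410442045704580462089310321033103610411162116311671183180724362668268826922814281828322833283728382841284253227664 ∷
  16401680188019101920287028802890292029303070308031103120313031403160317031803220332033303370338034103420437043804420458046209161037103810391042104310581066168217072311268926932707270827122713271627175197 ∷
  28402870288030703080309031103120313033203330336033704320433043404370438044204530457045804610462055810321033103410371038105310611182167718282684268827072708271127122828283428382857531453175318 ∷
  28402870288028902920293030703080309031103120313033204080409041204130414041704180432043304340437043804420457045804620558089310321158115911621163116711821678231126682684268827072814281728182833283728385164 ∷
  18802070211028402880307030803090312031303170318032703280332033303360337033804330434043704380442045704580462091709361034103810571183170217032336268426922708271227132834284228572858286251935314 ∷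
  18401880192019302070208021102120213030803090312031303140317031803320333033403370338034203570358036204380458046209090913093210581059106210671082157715782211258827092717271827322733273750685189 ∷
  164016801840188019201930207020802120288028902930308030903120313031403170318032203320333033603370338034204380442045804620909091709320936103810391043105810621684170723362568268927112713271727185197 ∷
  2840287028802890292029303070308031203130317041304140417041804330434043704380442046208931013103310341037116311671183168226682688269228092814281828372838284229587664 ∷
  164016801840188019202880289029202930294030803090312031303140317031803330337033803420414041804380442045804620909103810421044105810591062268926932708271227132717281928345169 ∷
  2840287028802890292029303070308030903110312031303170413041404170418041904330434043704380442045804620889089310331034103711631167118316822311266426682684268826922814281828332837283828425294 ∷
  287028802920293030703080311031203130316031703320333033603370418043304370438044104420457045804610462091610331037103810421057106111832688269126922707270827112712281828382841284251687814 ∷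
  28702880307030803090312031303170327032803320333033603370433043404370438044204570458046209090936103310371038105711831702170323362684268827072708271127122834283828422857519253145318 ∷
  20702110212028702880307030803110312031303160317032703310332033303360337043204330437043804420457045804610462103310371038106110661182118317021706268827082838284128422857285828612862519151925318 ∷
  19101920268028702880291029202930297030703080311031203130316031704120413041404170418042204320433043704380441044204621018103210331041116211631167118316861807266826882818282228372838284128422958517252987789 ∷
  28702880291029203070308031103120315031603170331033203360340041304170436043704380441044204560457046104620465103610371041105610571065116311671186168318312691269227072711271528132837284128425321 ∷
  287028802910292030703080311031204080412041304170418043204330436043704380441044204570458046104620558103210361041115811621163116711821186168128132816281728322833283628375293 ∷
  191028702880291029203070311031203130316031703310332033603370340034104370438044104420457046104620940103710381041104210571061170623402688269227072711271227152716283828422861531853215322 ∷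
  284028702880307030803110312031303310332033303360337043204330434043704380442045304570458046104621033103410371038105310611182118317061828268827072708271127122809282828382857286153175318 ∷
  207021103070308031103120313031603170331033203330336033704330437043804410442045704580461046204811057106110811183270827122838284128422856285728612862518851915192 ∷
  []

lowerCodes : List ℕ
lowerCodes =
  312031303170332033303370933106210631067170727082712284251885192 ∷
  3120313031603170336033703411062106617112712271651927688 ∷
  3120313031703370438044204620913091710621558268826922712283828425318 ∷
  28802920293031203130317033704621038104210622688269227125168 ∷
  3120316031703360337043704410461091710612692271228417813 ∷
  2880292031203160437046210371038104110421686281328172837 ∷
  31203130316031703370341046209130917106210631066268826922712271628385318 ∷
  28802920293031203130317043704621037103810422688269228375168 ∷
  16801880192031203130317033709130917106210632693271227132717 ∷
  2880292030803120437046210371038104216822311281328172837 ∷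
  2880308031204330437045710331037105728132817283228332837 ∷
  18801920212031203130317033709130917106210631558271327175193 ∷
  3080312031303320333033704370457105710582688270827125317 ∷
  28802920293030803120313043704621037103810421682268828172837 ∷
  2880308031203320433043704571033103710572813283328375317 ∷
  28802920308031204130417043704621033103716822813281728375293 ∷
  3080312033203360337043704571057105810612712283353135317 ∷
  3120316033203360437044104611057106117062837284153177813 ∷
  2920312031603360437044104611037104110612817283728417813 ∷
  30803120332033604330437045710371057106127112833283753135317 ∷
  30803120332033604330437045710571061170627112833283753135317 ∷
  18801920212021603120313031703370941106210631586271327175193 ∷
  18801920208021203120313031703370933106210631582271327175193 ∷
  []

opaque
  -- Opaque, so that the decoded families are unfolded only in the finite checks decided by
  -- evaluation. Those checks run on the decoded sets, so neither the numerals nor the fuel 60 has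
  -- to be trusted.
  upperSets lowerSets : List (List Element)
  upperSets = map (decode 60) upperCodes
  lowerSets = map (decode 60) lowerCodes

coveredBySome coversSome : List (List Element) → List Element → Bool
coveredBySome F A = any (A ⊑ᵇ_) F
coversSome F A = any (_⊑ᵇ A) F

holds : ∀ {b} → b ≡ true → T b
holds refl = tt

all-∈ : ∀ {A : Set} (f : A → Bool) xs → T (all f xs) → ∀ {x} → x ∈ xs → T (f x)
all-∈ f xs h = All.lookup (all⁺ f xs h)

-- The inclusions point in opposite directions: a successor may be enlarged to a member of the upper
-- family, and shrunk to a member of the lower one.
upperClosed lowerClosed : List (List Element) → List Element → Bool
upperClosed F A = (length (zeros A) ≤ᵇ 16) ∧ coveredBySome F (next 0 A) ∧ coveredBySome F (next 1 A)
lowerClosed F A = (7 ≤ᵇ length (zeros A)) ∧ coversSome F (next 0 A) ∧ coversSome F (next 1 A)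

allUpperClosed allLowerClosed : List (List Element) → Bool
allUpperClosed F = all (upperClosed F) F
allLowerClosed F = all (lowerClosed F) F

opaque
  unfolding upperSets lowerSets

  upperSets-closed : allUpperClosed upperSets ≡ true
  upperSets-closed = refl

  lowerSets-closed : allLowerClosed lowerSets ≡ true
  lowerSets-closed = refl

origin : Element
origin = el 0 0 0⁴

opaque
  -- The set of n = 0, which is its own child under the digit 0: five steps from the pair (0, 0)
  -- reach a set that a further step no longer enlarges up to `_⊑_`.
  S₀ : List Element
  S₀ = step 0 (step 0 (step 0 (step 0 (step 0 (origin ∷ [])))))

opaque
  unfolding S₀ upperSets

  origin∈S₀ : ((origin ∷ []) ⊑ᵇ S₀) ≡ true
  origin∈S₀ = refl

  S₀-closed : (next 0 S₀ ⊑ᵇ S₀) ≡ true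
  S₀-closed = refl

  S₀-upper : coveredBySome upperSets S₀ ≡ true
  S₀-upper = refl

-- Bounds for all lengths

child-induction : (P : ℕ → Set) → P 0 → (∀ {m f n} → Child m f n → P m → P n) → ∀ n → P n
child-induction P base ind = <-rec P λ where
  zero _ → base
  n@(suc _) rec → let (m , _ , c) = parent n in ind c (rec (child-< c (s≤s z≤n)))

zero-child : Child 0 0 0
zero-child = first

Under-step-zero : ∀ S → Under 0 S → Under 0 (step 0 S)
Under-step-zero S U = Under-⊑ (⊆⇒⊑ (minimals-⊆ (next 0 S))) (Under-next zero-child U)

opaque
  unfolding S₀

  Under-S₀ : Under 0 S₀
  Under-S₀ = Under-step-zero _ (Under-step-zero _ (Under-step-zero _ (Under-step-zero _ (Under-step-zero _ start))))
    where
    start : Under 0 (origin ∷ [])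
    start = mkUnder λ { (here refl) → realised 0 0 z≤n z≤n refl }

-- Here n = 0 does not decrease when passing to parents, so the induction is on i + j: a parent is
-- never larger and, unless i = j = 0, at least one of the two is strictly smaller.
Over-S₀ : Over 0 S₀
Over-S₀ = mkOver λ i j → <-rec P covered (i ℕ.+ j) i j refl
  where
  P : ℕ → Set
  P s = ∀ i j → i ℕ.+ j ≡ s → ¬ Above i j 0 → ¬ Below i j 0 → Covered S₀ i j 0
  descend : ∀ i j → 1 ≤ i ℕ.+ j → (∀ {s} → s < i ℕ.+ j → P s) → ¬ Above i j 0 → ¬ Below i j 0 → Covered S₀ i j 0
  descend i′ j′ pos rec ¬A ¬B with parent i′ | parent j′
  ... | i , _ , ci | j , _ , cj = Covered-⊑ i′ j′ 0 (⊑ᵇ-sound (next 0 S₀) S₀ (holds S₀-closed))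
    (Covered-next ci cj zero-child ¬A ¬B
      (rec (smaller i′ ci pos) i j refl (¬A ∘ Above-child ci cj zero-child) (¬B ∘ Below-child ci cj zero-child)))
    where
    smaller : ∀ i′ {d} → Child i d i′ → 1 ≤ i′ ℕ.+ j′ → i ℕ.+ j < i′ ℕ.+ j′
    smaller zero c h = ℕₚ.+-mono-≤-< (child-≤ c) (child-< cj h)
    smaller (suc _) c h = ℕₚ.+-mono-<-≤ (child-< c (s≤s z≤n)) (child-≤ cj)
  covered : ∀ s → (∀ {s′} → s′ < s → P s′) → P s
  covered _ rec zero zero refl _ _ = ⊑ᵇ-sound (origin ∷ []) S₀ (holds origin∈S₀) (here refl)
  covered _ rec zero j@(suc _) refl = descend zero j (s≤s z≤n) rec
  covered _ rec i@(suc _) j refl = descend i j (s≤s z≤n) rec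

Exact-S₀ : Exact 0 S₀
Exact-S₀ = exact Under-S₀ Over-S₀

Exact-exists : ∀ n → ∃ λ S → Exact n S
Exact-exists = child-induction _ (S₀ , Exact-S₀) λ c (S , E) → _ , Exact-step c E

Upper Lower : ℕ → Set
Upper n = ∃ λ A → A ∈ upperSets × Over n A
Lower n = ∃ λ A → A ∈ lowerSets × Under n A

enterUpper : ∀ {n S} → T (coveredBySome upperSets S) → Over n S → Upper n
enterUpper {n} {S} h O with find (any⁻ (S ⊑ᵇ_) upperSets h)
... | A , A∈ , S⊑A = A , A∈ , Over-⊑ (⊑ᵇ-sound S A S⊑A) O

enterLower : ∀ {n S} → T (coversSome lowerSets S) → Under n S → Lower n
enterLower {n} {S} h U with find (any⁻ (_⊑ᵇ S) lowerSets h)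
... | A , A∈ , A⊑S = A , A∈ , Under-⊑ (⊑ᵇ-sound A S A⊑S) U

upperSet-closed : ∀ {A} → A ∈ upperSets → length (zeros A) ≤ 16
  × T (coveredBySome upperSets (next 0 A)) × T (coveredBySome upperSets (next 1 A))
upperSet-closed {A} A∈ =
  let (bound , h) = ∧-elim (all-∈ (upperClosed upperSets) upperSets (holds upperSets-closed) A∈)
  in ℕₚ.≤ᵇ⇒≤ _ _ bound , ∧-elim h

lowerSet-closed : ∀ {A} → A ∈ lowerSets → 7 ≤ length (zeros A)
  × T (coversSome lowerSets (next 0 A)) × T (coversSome lowerSets (next 1 A))
lowerSet-closed {A} A∈ =
  let (bound , h) = ∧-elim (all-∈ (lowerClosed lowerSets) lowerSets (holds lowerSets-closed) A∈)
  in ℕₚ.≤ᵇ⇒≤ _ _ bound , ∧-elim h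

Upper-child : ∀ {m f n} → Child m f n → Upper m → Upper n
Upper-child c@first (A , A∈ , O) = enterUpper (proj₁ (proj₂ (upperSet-closed A∈))) (Over-next c O)
Upper-child c@(second _) (A , A∈ , O) = enterUpper (proj₂ (proj₂ (upperSet-closed A∈))) (Over-next c O)

Lower-child : ∀ {m f n} → Child m f n → Lower m → Lower n
Lower-child c@first (A , A∈ , U) = enterLower (proj₁ (proj₂ (lowerSet-closed A∈))) (Under-next c U)
Lower-child c@(second _) (A , A∈ , U) = enterLower (proj₂ (proj₂ (lowerSet-closed A∈))) (Under-next c U)

Upper-all : ∀ n → Upper n
Upper-all = child-induction Upper (enterUpper (holds S₀-upper) Over-S₀) Upper-child

Upper⇒≤16 : ∀ {n c} → Upper n → AbComplexity n c → c ≤ 16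
Upper⇒≤16 {n} {c} (A , A∈ , O) ab = ℕₚ.≤-trans (Over-≥ {n} {A} {c} O ab) (proj₁ (upperSet-closed A∈))

Lower⇒≥7 : ∀ {n c} → Lower n → AbComplexity n c → 7 ≤ c
Lower⇒≥7 {n} {c} (A , A∈ , U) ab = ℕₚ.≤-trans (proj₁ (lowerSet-closed A∈)) (Under-≤ {n} {A} {c} U ab)

-- node k r has the representation (1000)ᵏ followed by the first r ≤ 4 digits of 1000.
mutual
  W : ℕ → ℕ
  W zero = 0
  W (suc k) = node k 4

  node : ℕ → ℕ → ℕ
  node k 0 = W k
  node k 1 = suc (p (W k))
  node k (suc (suc r)) = p (node k (suc r))

block : ℕ → List Element → List Element
block 0 S = S
block 1 S = step 1 S
block (suc (suc r)) S = step 0 (block (suc r) S)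

q-W : ∀ k → qℕ (W k) ≡ 0
q-W zero = refl
q-W (suc k) = q-first (node k 3)

node-child : ∀ k → Child (W k) 1 (node k 1)
node-child k = second (subst (_< 3) (sym (q-W k)) (s≤s z≤n))

Exact-node : ∀ k {S} → Exact (W k) S → ∀ r → Exact (node k r) (block r S)
Exact-node k E 0 = E
Exact-node k E 1 = Exact-step (node-child k) E
Exact-node k E (suc (suc r)) = Exact-step first (Exact-node k E (suc r))

S₄ : List Element
S₄ = block 4 S₀

opaque
  unfolding S₀

  -- After the first block 1000 the set is reproduced, up to `_⊑_` in both directions, by every
  -- further block, so all `W (suc k)` share the set `S₄`.
  S₄-periodic : (block 4 S₄ ⊑ᵇ S₄ ∧ S₄ ⊑ᵇ block 4 S₄) ≡ true
  S₄-periodic = refl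

Exact-W : ∀ k → Exact (W (suc k)) S₄
Exact-W zero = Exact-node 0 Exact-S₀ 4
Exact-W (suc k) = Exact-≈ (block 4 S₄) S₄ (holds S₄-periodic) (Exact-node (suc k) (Exact-W k) 4)

leaves : ℕ → List Element → Bool
leaves f S = coversSome lowerSets (next f S)

-- The digit that does not continue (1000)ᵏ⁺¹ after its first 4k + r + 1 digits.
off : ℕ → ℕ
off 3 = 0
off _ = 1

leavesBlock : List Element → ℕ → Bool
leavesBlock S r = leaves (off r) (block (suc r) S)

leaves⇒Lower : ∀ {m f n S} → T (leaves f S) → Child m f n → Exact m S → Lower n
leaves⇒Lower h c E = enterLower h (Under-next c (under E))

Exact-3 : Exact 3 (step 1 (step 1 S₀))
Exact-3 = Exact-step {1} (second (s≤s (s≤s z≤n))) (Exact-step {0} (second (s≤s z≤n)) Exact-S₀)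

Exact-6 : Exact 6 (step 0 (step 1 (step 1 S₀)))
Exact-6 = Exact-step {3} first Exact-3

Exact-12 : Exact 12 (step 0 (step 0 (step 1 (step 1 S₀))))
Exact-12 = Exact-step {6} first Exact-6

four : List Element → Bool
four S = all (λ r → length (zeros (block (suc r) S)) ≡ᵇ 4) (upTo 4)

opaque
  unfolding S₀ lowerSets

  -- Index 0 is absent because leaving after the first digit 1 gives 3 = 11, followed by 6 = 110 and
  -- 12 = 1100, which have complexity 6. The ways out of this detour are checked separately.
  S₀-leaves : all (leavesBlock S₀) (1 ∷ 2 ∷ 3 ∷ []) ≡ true
  S₀-leaves = refl

  S₄-leaves : all (leavesBlock S₄) (0 ∷ 1 ∷ 2 ∷ 3 ∷ []) ≡ true
  S₄-leaves = refl

  3-leaves : leaves 1 (step 1 (step 1 S₀)) ≡ true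
  3-leaves = refl

  6-leaves : leaves 1 (step 0 (step 1 (step 1 S₀))) ≡ true
  6-leaves = refl

  12-leaves₀ : leaves 0 (step 0 (step 0 (step 1 (step 1 S₀)))) ≡ true
  12-leaves₀ = refl

  12-leaves₁ : leaves 1 (step 0 (step 0 (step 1 (step 1 S₀)))) ≡ true
  12-leaves₁ = refl

  S₀-four : four S₀ ≡ true
  S₀-four = refl

  S₄-four : four S₄ ≡ true
  S₄-four = refl

  3-six : length (zeros (step 1 (step 1 S₀))) ≡ 6
  3-six = refl

  6-six : length (zeros (step 0 (step 1 (step 1 S₀)))) ≡ 6
  6-six = refl

  12-six : length (zeros (step 0 (step 0 (step 1 (step 1 S₀))))) ≡ 6
  12-six = refl

-- An invariant under appending digits: a length is 0, lies on the path 1000 1000 ⋯, sits on the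
-- detour 11, 110, 1100, or has entered the lower family for good.
data Class : ℕ → Set where
  null : Class 0
  periodic : ∀ k r → r < 4 → Class (node k (suc r))
  three : Class 3
  six : Class 6
  twelve : Class 12
  lower : ∀ {n} → Lower n → Class n

off-path : ∀ k {S rs n} → T (all (leavesBlock S) rs) → Exact (W k) S → ∀ r → r ∈ rs → Child (node k (suc r)) (off r) n → Lower n
off-path k {S} {rs} h E r r∈ c = leaves⇒Lower (all-∈ (leavesBlock S) rs h r∈) c (Exact-node k E (suc r))

off₀ : ∀ {n} r → r ∈ 1 ∷ 2 ∷ 3 ∷ [] → Child (node 0 (suc r)) (off r) n → Class n
off₀ r r∈ c = lower (off-path 0 (holds S₀-leaves) Exact-S₀ r r∈ c)

off₊ : ∀ k {n} r → r ∈ 0 ∷ 1 ∷ 2 ∷ 3 ∷ [] → Child (node (suc k) (suc r)) (off r) n → Class n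
off₊ k r r∈ c = lower (off-path (suc k) (holds S₄-leaves) (Exact-W k) r r∈ c)

Class-periodic : ∀ k r {f n} → r < 4 → Child (node k (suc r)) f n → Class n
Class-periodic k 0 _ first = periodic k 1 (s≤s (s≤s z≤n))
Class-periodic k 1 _ first = periodic k 2 (s≤s (s≤s (s≤s z≤n)))
Class-periodic k 2 _ first = periodic k 3 (s≤s (s≤s (s≤s (s≤s z≤n))))
Class-periodic k 3 _ (second _) = periodic (suc k) 0 (s≤s z≤n)
Class-periodic zero 0 _ (second _) = three
Class-periodic zero 1 _ c@(second _) = off₀ 1 (here refl) c
Class-periodic zero 2 _ c@(second _) = off₀ 2 (there (here refl)) c
Class-periodic zero 3 _ c@first = off₀ 3 (there (there (here refl))) c
Class-periodic (suc k) 0 _ c@(second _) = off₊ k 0 (here refl) c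
Class-periodic (suc k) 1 _ c@(second _) = off₊ k 1 (there (here refl)) c
Class-periodic (suc k) 2 _ c@(second _) = off₊ k 2 (there (there (here refl))) c
Class-periodic (suc k) 3 _ c@first = off₊ k 3 (there (there (there (here refl)))) c
Class-periodic k (suc (suc (suc (suc _)))) (s≤s (s≤s (s≤s (s≤s ())))) _

Class-child : ∀ {m f n} → Child m f n → Class m → Class n
Class-child first null = null
Class-child (second _) null = periodic 0 0 (s≤s z≤n)
Class-child c (periodic k r r<4) = Class-periodic k r r<4 c
Class-child first three = six
Class-child c@(second _) three = lower (leaves⇒Lower (holds 3-leaves) c Exact-3)
Class-child first six = twelve
Class-child c@(second _) six = lower (leaves⇒Lower (holds 6-leaves) c Exact-6)
Class-child c@first twelve = lower (leaves⇒Lower (holds 12-leaves₀) c Exact-12)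
Class-child c@(second _) twelve = lower (leaves⇒Lower (holds 12-leaves₁) c Exact-12)
Class-child c (lower L) = lower (Lower-child c L)

classify : ∀ n → Class n
classify = child-induction Class null Class-child

Exact⇒AbComplexity-≡ : ∀ {n S c} → length (zeros S) ≡ c → Exact n S → AbComplexity n c
Exact⇒AbComplexity-≡ refl E = Exact⇒AbComplexity E

node-four : ∀ k {S} → T (four S) → Exact (W k) S → ∀ {r} → r < 4 → AbComplexity (node k (suc r)) 4
node-four k {S} h E {r} r<4 = Exact⇒AbComplexity-≡
  (ℕₚ.≡ᵇ⇒≡ _ 4 (all-∈ (λ r → length (zeros (block (suc r) S)) ≡ᵇ 4) (upTo 4) h (∈-upTo⁺ r<4)))
  (Exact-node k E (suc r))

AbComplexity-node : ∀ k {r} → r < 4 → AbComplexity (node k (suc r)) 4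
AbComplexity-node zero = node-four 0 (holds S₀-four) Exact-S₀
AbComplexity-node (suc k) = node-four (suc k) (holds S₄-four) (Exact-W k)

AbComplexity-3 : AbComplexity 3 6
AbComplexity-3 = Exact⇒AbComplexity-≡ 3-six Exact-3

AbComplexity-6 : AbComplexity 6 6
AbComplexity-6 = Exact⇒AbComplexity-≡ 6-six Exact-6

AbComplexity-12 : AbComplexity 12 6
AbComplexity-12 = Exact⇒AbComplexity-≡ 12-six Exact-12

-- The complexity is given as a relation; counting in one exact set for n makes it single-valued,
-- which excludes other values at the lengths already computed.
AbComplexity-unique : ∀ {n c c′} → AbComplexity n c → AbComplexity n c′ → c ≡ c′
AbComplexity-unique {n} {c} {c′} ab ab′ =
  let (S , E) = Exact-exists n in trans (Exact-≡ {n} {S} {c} E ab) (sym (Exact-≡ {n} {S} {c′} E ab′))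

-- Attaining the values 7 to 16 infinitely often

run : List Element → List ℕ → List Element
run S [] = S
run S (f ∷ w) = run (step f S) w

-- Here a is the letter at the current position, that is the number of ones just appended.
admissible : ℕ → List ℕ → Bool
admissible a [] = true
admissible a (0 ∷ w) = admissible 0 w
admissible a (1 ∷ w) = (a <ᵇ 3) ∧ admissible (suc a) w
admissible a _ = false

Exact-run : ∀ {n S} a w → qℕ n ≡ a → T (admissible a w) → Exact n S → ∃ λ n′ → n ≤ n′ × Exact n′ (run S w)
Exact-run {n} a [] _ _ E = n , ℕₚ.≤-refl , E
Exact-run {n} a (0 ∷ w) _ h E =
  let (n′ , n≤ , E′) = Exact-run 0 w (q-first n) h (Exact-step first E)
  in n′ , ℕₚ.≤-trans (child-≤ {n} first) n≤ , E′
Exact-run {n} a (1 ∷ w) refl h E =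
  let (lt , h′) = ∧-elim h
      q<3 = ℕₚ.<ᵇ⇒< a 3 lt
      (n′ , n≤ , E′) = Exact-run (suc a) w (q-second n q<3) h′ (Exact-step (second q<3) E)
  in n′ , ℕₚ.≤-trans (child-≤ {n} (second q<3)) n≤ , E′

-- Appended to (1000)ᵏ with k ≥ 1, this word yields a number of abelian complexity c.
tail : ℕ → List ℕ
tail 7 = 0 ∷ []
tail 8 = 0 ∷ 0 ∷ 1 ∷ []
tail 9 = 1 ∷ 1 ∷ 1 ∷ []
tail 10 = 1 ∷ 0 ∷ 1 ∷ 1 ∷ []
tail 11 = 1 ∷ 1 ∷ 1 ∷ 0 ∷ 0 ∷ []
tail 12 = 0 ∷ 0 ∷ 1 ∷ 0 ∷ 0 ∷ 0 ∷ 0 ∷ 0 ∷ []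
tail 13 = 1 ∷ 0 ∷ 1 ∷ 0 ∷ 1 ∷ 0 ∷ 1 ∷ 1 ∷ 0 ∷ []
tail 14 = 1 ∷ 1 ∷ 1 ∷ 0 ∷ 0 ∷ 0 ∷ 0 ∷ 0 ∷ 0 ∷ 0 ∷ []
tail 15 = 1 ∷ 0 ∷ 1 ∷ 1 ∷ 1 ∷ 0 ∷ 1 ∷ 0 ∷ 1 ∷ 1 ∷ 0 ∷ 0 ∷ 0 ∷ []
tail 16 = 1 ∷ 0 ∷ 1 ∷ 0 ∷ 1 ∷ 0 ∷ 1 ∷ 0 ∷ 1 ∷ 0 ∷ 1 ∷ 0 ∷ 1 ∷ 1 ∷ 0 ∷ []
tail _ = []

tail-correct : ℕ → Bool
tail-correct c = admissible 0 (tail c) ∧ (length (zeros (run S₄ (tail c))) ≡ᵇ c)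

opaque
  unfolding S₀

  tails-correct : all tail-correct (applyUpTo (7 ℕ.+_) 10) ≡ true
  tails-correct = refl

k≤W : ∀ k → k ≤ W k
k≤W zero = z≤n
k≤W (suc k) = ℕₚ.≤-trans (s≤s (k≤W k)) (ℕₚ.≤-trans (child-< (node-child k) (s≤s z≤n))
  (ℕₚ.≤-trans (child-≤ {node k 1} first) (ℕₚ.≤-trans (child-≤ {node k 2} first) (child-≤ {node k 3} first))))

infinitely-often : ∀ c → 7 ≤ c → c ≤ 16 → ∀ m → ∃ λ n → m < n × AbComplexity n c
infinitely-often c 7≤c c≤16 m =
  let c∈ = subst (_∈ applyUpTo (7 ℕ.+_) 10) (ℕₚ.m+[n∸m]≡n 7≤c) (∈-applyUpTo⁺ (7 ℕ.+_) {c ℕ.∸ 7} {10} (s≤s (ℕₚ.∸-monoˡ-≤ 7 c≤16)))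
      (adm , eq) = ∧-elim (all-∈ tail-correct (applyUpTo (7 ℕ.+_) 10) (holds tails-correct) c∈)
      -- The set after `tail c` does not depend on the number of blocks in front, so m + 1 blocks
      -- are taken; `k≤W` then pushes the length beyond m.
      (n , W≤n , E) = Exact-run 0 (tail c) (q-W (suc m)) adm (Exact-W m)
  in n , ℕₚ.≤-trans (k≤W (suc m)) W≤n , Exact⇒AbComplexity-≡ (ℕₚ.≡ᵇ⇒≡ _ c eq) E

-- Representations in base Q

value : List Bool → ℕ
value [] = 0
value (b ∷ w) = (if b then Q (4 ℕ.+ length w) else 0) ℕ.+ value w

Q-+4 : ∀ j → Q (j ℕ.+ 4) ≡ Q (4 ℕ.+ j)
Q-+4 j = cong Q (ℕₚ.+-comm j 4)

Q-step : ∀ j → Q (4 ℕ.+ j) ≤ Q (5 ℕ.+ j)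
Q-step j = ℕₚ.≤-trans (ℕₚ.m≤m+n _ _) (ℕₚ.≤-trans (ℕₚ.m≤m+n _ _) (ℕₚ.m≤m+n _ (Q (1 ℕ.+ j))))

-- Ensures that after the greedy algorithm takes a digit 1, the remainder is below the same Q-term,
-- so no digit 2 would ever be called for.
Q-double : ∀ j → Q (5 ℕ.+ j) ≤ Q (4 ℕ.+ j) ℕ.+ Q (4 ℕ.+ j)
Q-double j = subst (_≤ Q (4 ℕ.+ j) ℕ.+ Q (4 ℕ.+ j)) (assoc (Q (4 ℕ.+ j)) (Q (3 ℕ.+ j)) (Q (2 ℕ.+ j)) (Q (1 ℕ.+ j)))
  (ℕₚ.+-monoʳ-≤ (Q (4 ℕ.+ j)) (ℕₚ.m≤m+n (Q (3 ℕ.+ j) ℕ.+ Q (2 ℕ.+ j) ℕ.+ Q (1 ℕ.+ j)) (Q j)))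
  where
  assoc : ∀ a b c d → a ℕ.+ (b ℕ.+ c ℕ.+ d) ≡ a ℕ.+ b ℕ.+ c ℕ.+ d
  assoc a b c d = trans (sym (ℕₚ.+-assoc a (b ℕ.+ c) d)) (cong (ℕ._+ d) (sym (ℕₚ.+-assoc a b c)))

1≤Q : ∀ j → 1 ≤ Q (4 ℕ.+ j)
1≤Q zero = s≤s z≤n
1≤Q (suc j) = ℕₚ.≤-trans (1≤Q j) (Q-step j)

Q-grows : ∀ j → suc j ≤ Q (4 ℕ.+ j)
Q-grows 0 = s≤s z≤n
Q-grows 1 = s≤s (s≤s z≤n)
Q-grows (suc (suc j)) = ℕₚ.≤-trans
  (ℕₚ.≤-trans (ℕₚ.≤-reflexive (cong suc (sym (ℕₚ.+-comm (suc j) 1)))) (ℕₚ.+-mono-≤ (Q-grows (suc j)) (1≤Q j)))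
  (ℕₚ.≤-trans (ℕₚ.m≤m+n _ (Q (3 ℕ.+ j))) (ℕₚ.m≤m+n _ (Q (2 ℕ.+ j))))

Q-mono : ∀ {i j} → i ≤ j → Q (4 ℕ.+ i) ≤ Q (4 ℕ.+ j)
Q-mono {i} i≤j = go (ℕₚ.≤⇒≤′ i≤j)
  where
  go : ∀ {j} → i ℕ.≤′ j → Q (4 ℕ.+ i) ≤ Q (4 ℕ.+ j)
  go ℕ.≤′-refl = ℕₚ.≤-refl
  go (ℕ.≤′-step {j} h) = ℕₚ.≤-trans (go h) (Q-step j)

if-≤ : ∀ {A : Set} {x y : A} {m n} → m ≤ n → (if does (m ≤? n) then x else y) ≡ x
if-≤ {x = x} {y} {m} {n} h = cong (if_then x else y) (dec-true (m ≤? n) h)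

if-> : ∀ {A : Set} {x y : A} {m n} → n < m → (if does (m ≤? n) then x else y) ≡ y
if-> {x = x} {y} {m} {n} h = cong (if_then x else y) (dec-false (m ≤? n) (ℕₚ.<⇒≱ h))

greedy-true : ∀ {j r} → Q (4 ℕ.+ j) ≤ r → greedy (suc j) r ≡ true ∷ greedy j (r ∸ Q (4 ℕ.+ j))
greedy-true {j} {r} h = trans (if-≤ (subst (_≤ r) (sym (Q-+4 j)) h)) (cong (λ m → true ∷ greedy j (r ∸ m)) (Q-+4 j))

greedy-false : ∀ {j r} → r < Q (4 ℕ.+ j) → greedy (suc j) r ≡ false ∷ greedy j r
greedy-false {j} {r} h = if-> (subst (r <_) (sym (Q-+4 j)) h)

topIndex-hit : ∀ {j n} → Q (5 ℕ.+ j) ≤ n → topIndex n (suc j) ≡ suc j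
topIndex-hit {j} {n} h = if-≤ (subst (_≤ n) (sym (Q-+4 (suc j))) h)

topIndex-miss : ∀ {j n} → n < Q (5 ℕ.+ j) → topIndex n (suc j) ≡ topIndex n j
topIndex-miss {j} {n} h = if-> (subst (n <_) (sym (Q-+4 (suc j))) h)

length-greedy : ∀ j r → length (greedy j r) ≡ j
length-greedy zero r = refl
length-greedy (suc j) r with does (Q (j ℕ.+ 4) ≤? r)
... | true = cong suc (length-greedy j _)
... | false = cong suc (length-greedy j _)

value-greedy : ∀ j r → r < Q (4 ℕ.+ j) → value (greedy j r) ≡ r
value-greedy zero zero _ = refl
value-greedy zero (suc r) (s≤s ())
value-greedy (suc j) r h with Q (4 ℕ.+ j) ≤? r
... | yes q≤r = trans (cong value (greedy-true {j} q≤r)) (trans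
  (cong₂ ℕ._+_ (cong (λ l → Q (4 ℕ.+ l)) (length-greedy j _)) (value-greedy j _
    (ℕₚ.+-cancelˡ-< (Q (4 ℕ.+ j)) _ _ (ℕₚ.<-≤-trans (subst (_< Q (5 ℕ.+ j)) (sym (ℕₚ.m+[n∸m]≡n q≤r)) h) (Q-double j)))))
  (ℕₚ.m+[n∸m]≡n q≤r))
... | no q≰r = trans (cong value (greedy-false {j} (ℕₚ.≰⇒> q≰r))) (value-greedy j r (ℕₚ.≰⇒> q≰r))

topIndex-bound : ∀ n b → n < Q (5 ℕ.+ b) → n < Q (5 ℕ.+ topIndex n b)
topIndex-bound n zero h = h
topIndex-bound n (suc b) h with Q (5 ℕ.+ b) ≤? n
... | yes q≤n = subst (λ t → n < Q (5 ℕ.+ t)) (sym (topIndex-hit {b} q≤n)) h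
... | no q≰n = subst (λ t → n < Q (5 ℕ.+ t)) (sym (topIndex-miss {b} (ℕₚ.≰⇒> q≰n))) (topIndex-bound n b (ℕₚ.≰⇒> q≰n))

value-rep : ∀ n → value (rep n) ≡ n
value-rep n = value-greedy (suc (topIndex n n)) n
  (topIndex-bound n n (ℕₚ.<-trans (ℕₚ.n<1+n n) (Q-grows (suc n))))

-- The search runs downwards and Q is monotone, so every index above k misses and k is the first
-- hit.
topIndex-unique : ∀ {n k} b → k ℕ.≤′ b → Q (4 ℕ.+ k) ≤ n → n < Q (5 ℕ.+ k) → topIndex n b ≡ k
topIndex-unique zero ℕ.≤′-refl _ _ = refl
topIndex-unique (suc b) ℕ.≤′-refl lo hi = topIndex-hit {b} lo
topIndex-unique (suc b) (ℕ.≤′-step k≤b) lo hi =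
  trans (topIndex-miss {b} (ℕₚ.<-≤-trans hi (Q-mono (s≤s (ℕₚ.≤′⇒≤ k≤b))))) (topIndex-unique b k≤b lo hi)

digit : ℕ → Bool
digit i = (i % 4) ≡ᵇ 0

length-pattern : ∀ L → length (pattern1000 L) ≡ L
length-pattern L = trans (length-map _ (upTo L)) (length-upTo L)

pattern-4+ : ∀ L → pattern1000 (4 ℕ.+ L) ≡ true ∷ false ∷ false ∷ false ∷ pattern1000 L
pattern-4+ L = trans (map-upTo digit (4 ℕ.+ L)) (cong (λ w → true ∷ false ∷ false ∷ false ∷ w) (sym (map-upTo digit L)))

value-pattern-4+ : ∀ L → value (pattern1000 (4 ℕ.+ L)) ≡ Q (7 ℕ.+ L) ℕ.+ value (pattern1000 L)
value-pattern-4+ L = trans (cong value (pattern-4+ L)) (cong (λ l → Q (7 ℕ.+ l) ℕ.+ value (pattern1000 L)) (length-pattern L))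

value-pattern-< : ∀ L → value (pattern1000 L) < Q (4 ℕ.+ L)
value-pattern-< 0 = s≤s z≤n
value-pattern-< 1 = s≤s (s≤s z≤n)
value-pattern-< 2 = s≤s (s≤s (s≤s z≤n))
value-pattern-< 3 = s≤s (s≤s (s≤s (s≤s (s≤s z≤n))))
value-pattern-< (suc (suc (suc (suc L)))) = subst (_< Q (8 ℕ.+ L)) (sym (value-pattern-4+ L))
  (ℕₚ.<-≤-trans (ℕₚ.+-monoʳ-< (Q (7 ℕ.+ L)) (value-pattern-< L))
  (ℕₚ.≤-trans (ℕₚ.+-monoʳ-≤ (Q (7 ℕ.+ L)) (ℕₚ.≤-trans (Q-step L) (Q-step (suc L))))
  (ℕₚ.≤-trans (ℕₚ.m≤m+n _ (Q (5 ℕ.+ L))) (ℕₚ.m≤m+n _ (Q (4 ℕ.+ L))))))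

value-pattern-≥ : ∀ L → Q (4 ℕ.+ L) ≤ value (pattern1000 (suc L))
value-pattern-≥ 0 = ℕₚ.≤-refl
value-pattern-≥ 1 = ℕₚ.≤-refl
value-pattern-≥ 2 = ℕₚ.≤-refl
value-pattern-≥ (suc (suc (suc L))) = subst (Q (7 ℕ.+ L) ≤_) (sym (value-pattern-4+ L)) (ℕₚ.m≤m+n _ _)

-- Once the leading 1 is removed, the remainder is the value of the pattern four digits shorter,
-- hence too small for the next three Q-terms.
greedy-pattern : ∀ L → greedy L (value (pattern1000 L)) ≡ pattern1000 L
greedy-pattern 0 = refl
greedy-pattern 1 = refl
greedy-pattern 2 = refl
greedy-pattern 3 = refl
greedy-pattern (suc (suc (suc (suc L)))) = trans (cong (greedy (4 ℕ.+ L)) (value-pattern-4+ L))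
  (trans (greedy-true {3 ℕ.+ L} (ℕₚ.m≤m+n _ _))
  (trans (cong (λ r → true ∷ greedy (3 ℕ.+ L) r) (ℕₚ.m+n∸m≡n (Q (7 ℕ.+ L)) v))
  (trans (cong (true ∷_) zeros₃) (sym (pattern-4+ L)))))
  where
  v : ℕ
  v = value (pattern1000 L)
  v<₀ : v < Q (4 ℕ.+ L)
  v<₀ = value-pattern-< L
  v<₁ : v < Q (5 ℕ.+ L)
  v<₁ = ℕₚ.<-≤-trans v<₀ (Q-step L)
  v<₂ : v < Q (6 ℕ.+ L)
  v<₂ = ℕₚ.<-≤-trans v<₁ (Q-step (suc L))
  zeros₃ : greedy (3 ℕ.+ L) v ≡ false ∷ false ∷ false ∷ pattern1000 L
  zeros₃ = trans (greedy-false {2 ℕ.+ L} v<₂) (cong (false ∷_)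
    (trans (greedy-false {1 ℕ.+ L} v<₁) (cong (false ∷_) (trans (greedy-false {L} v<₀) (cong (false ∷_) (greedy-pattern L))))))

rep-pattern : ∀ L → rep (value (pattern1000 (suc L))) ≡ pattern1000 (suc L)
rep-pattern L = trans (cong (λ t → greedy (suc t) v) (topIndex-unique v (ℕₚ.≤⇒≤′ L≤v) (value-pattern-≥ L) (value-pattern-< (suc L))))
  (greedy-pattern (suc L))
  where
  v : ℕ
  v = value (pattern1000 (suc L))
  L≤v : L ≤ v
  L≤v = ℕₚ.≤-trans (ℕₚ.n≤1+n L) (ℕₚ.≤-trans (Q-grows L) (value-pattern-≥ L))

-- The Parikh vector of σᵏ(0), since M (+ 0) (Q⁴ k) = Q⁴ (suc k).
Q⁴ : ℕ → ℤ⁴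
Q⁴ k = ⟨ + Q (3 ℕ.+ k) , + Q (2 ℕ.+ k) , + Q (1 ℕ.+ k) , + Q k ⟩

-- The number alone does not determine how its value changes when the digits shift by one place.
-- Four consecutive Q-terms do, and on them the shift acts by the same matrix `M` that governs `ψ`.
value⁴ : List Bool → ℤ⁴
value⁴ [] = 0⁴
value⁴ (b ∷ w) = (if b then Q⁴ (length w) else 0⁴) ⊕ value⁴ w

total-value⁴ : ∀ w → total (value⁴ w) ≡ + value w
total-value⁴ [] = refl
total-value⁴ (true ∷ w) = trans (Λ-⊕ 0 (Q⁴ (length w)) (value⁴ w)) (cong (λ z → + Q (4 ℕ.+ length w) + z) (total-value⁴ w))
total-value⁴ (false ∷ w) = trans (Λ-⊕ 0 0⁴ (value⁴ w)) (trans (ℤₚ.+-identityˡ _) (total-value⁴ w))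

bit : Bool → ℕ
bit b = if b then 1 else 0

M-⊕ : ∀ c u v → M (+ 0) u ⊕ M c v ≡ M c (u ⊕ v)
M-⊕ c u v = ⟨⟩-cong (eq c (x₀ u) (x₁ u) (x₂ u) (x₃ u) (x₀ v) (x₁ v) (x₂ v) (x₃ v)) refl refl refl
  where
  eq : ∀ c a b d e a′ b′ d′ e′ → a + b + d + e + + 0 + (a′ + b′ + d′ + e′ + c)
     ≡ a + a′ + (b + b′) + (d + d′) + (e + e′) + c
  eq = solve-∀

value⁴-∷ʳ : ∀ w b → value⁴ (w ++ [ b ]) ≡ M (+ bit b) (value⁴ w)
value⁴-∷ʳ [] true = refl
value⁴-∷ʳ [] false = refl
value⁴-∷ʳ (a ∷ w) b = trans (cong₂ _⊕_ (shift a) (value⁴-∷ʳ w b)) (M-⊕ (+ bit b) (if a then Q⁴ (length w) else 0⁴) (value⁴ w))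
  where
  length-∷ʳ : length (w ++ [ b ]) ≡ suc (length w)
  length-∷ʳ = trans (length-++ w) (ℕₚ.+-comm (length w) 1)
  shift : ∀ a → (if a then Q⁴ (length (w ++ [ b ])) else 0⁴) ≡ M (+ 0) (if a then Q⁴ (length w) else 0⁴)
  shift true = trans (cong Q⁴ length-∷ʳ) (⟨⟩-cong (sym (ℤₚ.+-identityʳ _)) refl refl refl)
  shift false = refl

-- Both sides change by `M` with the same digit. Comparing totals at the end identifies the
-- positions on the path with the values of the digit strings.
ψ-pattern : ∀ L {m n b} → digit L ≡ b → Child m (bit b) n → ψ m ≡ value⁴ (pattern1000 L) → ψ n ≡ value⁴ (pattern1000 (suc L))
ψ-pattern L refl c eq = trans (ψ-child c) (trans (cong (M (+ bit (digit L))) eq)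
  (trans (sym (value⁴-∷ʳ (pattern1000 L) (digit L))) (cong value⁴ (sym snoc))))
  where
  snoc : pattern1000 (suc L) ≡ pattern1000 L ++ [ digit L ]
  snoc = trans (cong (map _) (sym (upTo-∷ʳ L))) (map-++ _ (upTo L) [ L ])

digits : ∀ k → digit (k ℕ.* 4) ≡ true × digit (1 ℕ.+ k ℕ.* 4) ≡ false
  × digit (2 ℕ.+ k ℕ.* 4) ≡ false × digit (3 ℕ.+ k ℕ.* 4) ≡ false
digits zero = refl , refl , refl , refl
digits (suc k) = digits k

mutual
  ψ-W : ∀ k → ψ (W k) ≡ value⁴ (pattern1000 (k ℕ.* 4))
  ψ-W zero = refl
  ψ-W (suc k) = ψ-node k 3 (ℕₚ.n<1+n 3)

  ψ-node : ∀ k r → r < 4 → ψ (node k (suc r)) ≡ value⁴ (pattern1000 (suc r ℕ.+ k ℕ.* 4))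
  ψ-node k 0 _ = ψ-pattern (k ℕ.* 4) (proj₁ (digits k)) (node-child k) (ψ-W k)
  ψ-node k 1 _ = ψ-pattern (1 ℕ.+ k ℕ.* 4) (proj₁ (proj₂ (digits k))) (first {node k 1}) (ψ-node k 0 (s≤s z≤n))
  ψ-node k 2 _ = ψ-pattern (2 ℕ.+ k ℕ.* 4) (proj₁ (proj₂ (proj₂ (digits k)))) (first {node k 2}) (ψ-node k 1 (s≤s (s≤s z≤n)))
  ψ-node k 3 _ = ψ-pattern (3 ℕ.+ k ℕ.* 4) (proj₂ (proj₂ (proj₂ (digits k)))) (first {node k 3}) (ψ-node k 2 (s≤s (s≤s (s≤s z≤n))))
  ψ-node k (suc (suc (suc (suc _)))) (s≤s (s≤s (s≤s (s≤s ()))))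

node-value : ∀ k {r} → r < 4 → node k (suc r) ≡ value (pattern1000 (suc r ℕ.+ k ℕ.* 4))
node-value k {r} r<4 = ℤₚ.+-injective (trans (sym (total-ψ (node k (suc r))))
  (trans (cong total (ψ-node k r r<4)) (total-value⁴ (pattern1000 (suc r ℕ.+ k ℕ.* 4)))))

node-prefix : ∀ k {r} → r < 4 → IsPrefixOf1000 (rep (node k (suc r)))
node-prefix k {r} r<4 = subst (λ w → w ≡ pattern1000 (length w)) (sym eq) (cong pattern1000 (sym (length-pattern L)))
  where
  L : ℕ
  L = suc r ℕ.+ k ℕ.* 4
  eq : rep (node k (suc r)) ≡ pattern1000 L
  eq = trans (cong rep (node-value k r<4)) (rep-pattern (r ℕ.+ k ℕ.* 4))

prefix-node : ∀ n → IsPrefixOf1000 (rep n) → ∃ λ k → ∃ λ r → r < 4 × n ≡ node k (suc r)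
-- The representation has L + 1 digits: L / 4 complete blocks and then L % 4 + 1 digits of a block,
-- which is possibly complete as well.
prefix-node n h = L / 4 , L % 4 , m%n<n L 4 , trans (sym (value-rep n)) (trans (cong value h)
  (trans (cong (λ l → value (pattern1000 l)) (trans (length-greedy (suc L) n) (cong suc (m≡m%n+[m/n]*n L 4))))
  (sym (node-value (L / 4) (m%n<n L 4)))))
  where
  L : ℕ
  L = topIndex n n

-- Assembly of the four claims

6-in-range : ∀ {c} → c ≡ 6 → 6 ≤ c × c ≤ 16
6-in-range refl = ℕₚ.≤-refl , ℕₚ.m≤m+n 6 10

range : ∀ {n c} → 1 ≤ n → Class n → AbComplexity n c → c ≡ 4 ⊎ (6 ≤ c × c ≤ 16)
range () null _
range {c = c} _ (periodic k r r<4) ab = inj₁ (AbComplexity-unique {node k (suc r)} {c} {4} ab (AbComplexity-node k r<4))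
range {c = c} _ three ab = inj₂ (6-in-range (AbComplexity-unique {3} {c} {6} ab AbComplexity-3))
range {c = c} _ six ab = inj₂ (6-in-range (AbComplexity-unique {6} {c} {6} ab AbComplexity-6))
range {c = c} _ twelve ab = inj₂ (6-in-range (AbComplexity-unique {12} {c} {6} ab AbComplexity-12))
range {n} {c} _ (lower L) ab =
  inj₂ (ℕₚ.≤-trans (ℕₚ.n≤1+n 6) (Lower⇒≥7 {n} {c} L ab) , Upper⇒≤16 {n} {c} (Upper-all n) ab)

attained : ∀ c → c ≡ 4 ⊎ (6 ≤ c × c ≤ 16) → ∃ λ n → 1 ≤ n × AbComplexity n c
attained c (inj₁ refl) = 1 , s≤s z≤n , AbComplexity-node 0 {0} (s≤s z≤n)
attained c (inj₂ (6≤c , c≤16)) = split (ℕₚ.m≤n⇒m<n∨m≡n 6≤c)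
  where
  split : 7 ≤ c ⊎ 6 ≡ c → ∃ λ n → 1 ≤ n × AbComplexity n c
  split (inj₁ 7≤c) = infinitely-often c 7≤c c≤16 0
  split (inj₂ refl) = 3 , s≤s z≤n , AbComplexity-3

4⇒prefix : ∀ {n} → 1 ≤ n → Class n → AbComplexity n 4 → IsPrefixOf1000 (rep n)
4⇒prefix () null _
4⇒prefix _ (periodic k r r<4) _ = node-prefix k r<4
-- Subtracting 4 turns the equation 4 = 6 into 0 = 2.
4⇒prefix _ three ab = ⊥-elim (ℕₚ.1+n≢0 (sym (cong (_∸ 4) (AbComplexity-unique {3} {4} {6} ab AbComplexity-3))))
4⇒prefix _ six ab = ⊥-elim (ℕₚ.1+n≢0 (sym (cong (_∸ 4) (AbComplexity-unique {6} {4} {6} ab AbComplexity-6))))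
4⇒prefix _ twelve ab = ⊥-elim (ℕₚ.1+n≢0 (sym (cong (_∸ 4) (AbComplexity-unique {12} {4} {6} ab AbComplexity-12))))
4⇒prefix {n} _ (lower L) ab = ⊥-elim (ℕₚ.m+n≮m 4 2 (Lower⇒≥7 {n} {4} L ab))

prefix⇒4 : ∀ n → IsPrefixOf1000 (rep n) → AbComplexity n 4
prefix⇒4 n h = let (k , r , r<4 , eq) = prefix-node n h in subst (λ m → AbComplexity m 4) (sym eq) (AbComplexity-node k r<4)

6⇒3∨6∨12 : ∀ {n} → 1 ≤ n → Class n → AbComplexity n 6 → n ≡ 3 ⊎ n ≡ 6 ⊎ n ≡ 12
6⇒3∨6∨12 () null _
6⇒3∨6∨12 _ (periodic k r r<4) ab =
  ⊥-elim (ℕₚ.1+n≢0 (cong (_∸ 4) (AbComplexity-unique {node k (suc r)} {6} {4} ab (AbComplexity-node k r<4))))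
6⇒3∨6∨12 _ three _ = inj₁ refl
6⇒3∨6∨12 _ six _ = inj₂ (inj₁ refl)
6⇒3∨6∨12 _ twelve _ = inj₂ (inj₂ refl)
6⇒3∨6∨12 {n} _ (lower L) ab = ⊥-elim (ℕₚ.<-irrefl refl (Lower⇒≥7 {n} {6} L ab))

3∨6∨12⇒6 : ∀ {n} → n ≡ 3 ⊎ n ≡ 6 ⊎ n ≡ 12 → AbComplexity n 6
3∨6∨12⇒6 (inj₁ refl) = AbComplexity-3
3∨6∨12⇒6 (inj₂ (inj₁ refl)) = AbComplexity-6
3∨6∨12⇒6 (inj₂ (inj₂ refl)) = AbComplexity-12

complexity : ∀ n → 1 ≤ n → ∃ λ c → AbComplexity n c × (c ≡ 4 ⊎ (6 ≤ c × c ≤ 16))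
complexity n 1≤n =
  let (S , E) = Exact-exists n
      ab = Exact⇒AbComplexity E
  in length (zeros S) , ab , range {n} {length (zeros S)} 1≤n (classify n) ab

theorem14 : ((∀ n → 1 ≤ n → ∃ λ c → AbComplexity n c × (c ≡ 4 ⊎ (6 ≤ c × c ≤ 16)))
    × (∀ c → (c ≡ 4 ⊎ (6 ≤ c × c ≤ 16)) → ∃ λ n → 1 ≤ n × AbComplexity n c))
    × (∀ n → 1 ≤ n → (AbComplexity n 4 ⇔ IsPrefixOf1000 (rep n)))
    × (∀ n → 1 ≤ n → (AbComplexity n 6 ⇔ (n ≡ 3 ⊎ n ≡ 6 ⊎ n ≡ 12)))
    × (∀ c → 7 ≤ c → c ≤ 16 → ∀ m → ∃ λ n → m < n × AbComplexity n c)
theorem14 = (complexity , attained)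
  , (λ n 1≤n → mk⇔ (4⇒prefix 1≤n (classify n)) (prefix⇒4 n))
  , (λ n 1≤n → mk⇔ (6⇒3∨6∨12 1≤n (classify n)) 3∨6∨12⇒6)
  , infinitely-often
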